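{- Let $\mathcal{X}$ be a hereditary graph class that is small and weakly sparse. Then $\mathcal{X}$ has bounded expansion.
   Context: A class of graphs is a set of graphs closed under isomorphism. It is hereditary if it is closed under taking induced subgraphs. For a class $\mathcal{X}$, $\mathcal{X}_n$ denotes the set of graphs in $\mathcal{X}$ with vertex set $[n]$ (labeled graphs; isomorphic but distinct labeled graphs are counted separately). A hereditary class $\mathcal{X}$ is small if there is a constant $c$ such that $|\mathcal{X}_n| \le n!\cdot c^n$ for every $n\in\mathbb{N}$. A hereditary class is weakly sparse if there is an integer $t$ such that the complete bipartite graph $K_{t,t}$ is not a (not necessarily induced) subgraph of any graph in the class. For an integer $r\ge 0$, the $r$-subdivision of a graph $G$ is obtained by replacing each edge by a path with $r$ internal (new) vertices (the $0$-subdivision is $G$ itself). A class $\mathcal{C}$ has bounded expansion if there is a function $f:\mathbb{N}\to\mathbb{R}$ such that for every integer $r\ge 0$, no $r$-subdivision of a graph of average degree larger than $f(r)$ is a subgraph of a graph in $\mathcal{C}$. -}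

module Defs where

open import Data.Nat using (ℕ; zero; suc; _+_; _*_; _^_; _≤_; _<_; _≡ᵇ_)
open import Data.Nat using (_!)
open import Data.Bool using (Bool; true; false; _∧_; _∨_; T)
open import Data.Fin using (Fin; toℕ; _≟_)
import Data.Fin as F
open import Data.List using (List; length; map; filter)
open import Data.Nat.ListAction using (sum)
open import Data.List using () renaming (allFin to allFinL)
open import Data.List.Relation.Unary.All using (All)
open import Data.List.Relation.Unary.AllPairs using (AllPairs)
open import Data.Product using (Σ; ∃; ∃-syntax; _×_; _,_; proj₁; proj₂)
open import Data.Sum using (_⊎_; inj₁; inj₂)
open import Relation.Nullary using (¬_)
open import Relation.Nullary.Decidable using (⌊_⌋)
open import Relation.Binary.PropositionalEquality using (_≡_)
open import Function.Definitions using (Injective; Bijective)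

record Graph (V : Set) : Set where
  field
    adj    : V → V → Bool
    sym    : ∀ u v → adj u v ≡ adj v u
    irrefl : ∀ v → adj v v ≡ false
open Graph public

-- Labeled graphs on vertex set [n] are represented as Graph (Fin n).
-- A "class" is given by a membership predicate on labeled graphs.
GraphPred : Set₁
GraphPred = ∀ {n} → Graph (Fin n) → Set

IsoClosed : GraphPred → Set
IsoClosed X = ∀ {n m} (G : Graph (Fin n)) (H : Graph (Fin m)) (σ : Fin n → Fin m) →
  Bijective _≡_ _≡_ σ → (∀ i j → adj G i j ≡ adj H (σ i) (σ j)) → X G → X H

induced : ∀ {n m} → Graph (Fin n) → (Fin m → Fin n) → Graph (Fin m)
induced G ι = record
  { adj = λ i j → adj G (ι i) (ι j)
  ; sym = λ i j → sym G (ι i) (ι j)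
  ; irrefl = λ i → irrefl G (ι i) }

Hereditary : GraphPred → Set
Hereditary X = ∀ {n m} (G : Graph (Fin n)) (ι : Fin m → Fin n) →
  Injective _≡_ _≡_ ι → X G → X (induced G ι)

SameGraph : ∀ {n} → Graph (Fin n) → Graph (Fin n) → Set
SameGraph G H = ∀ i j → adj G i j ≡ adj H i j

-- |X_n| ≤ n! c^n: every list of pairwise distinct members of X_n has length ≤ n! c^n
Small : GraphPred → Set
Small X = Σ ℕ λ c → ∀ n (L : List (Graph (Fin n))) → All X L →
  AllPairs (λ G H → ¬ SameGraph G H) L → length L ≤ (n !) * c ^ n

_⊆ᵍ_ : ∀ {V W : Set} → (V → V → Bool) → (W → W → Bool) → Set
_⊆ᵍ_ {V} {W} H G = Σ (V → W) λ φ → Injective _≡_ _≡_ φ × (∀ x y → T (H x y) → T (G (φ x) (φ y)))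

Ktt : (t : ℕ) → Fin t ⊎ Fin t → Fin t ⊎ Fin t → Bool
Ktt t (inj₁ _) (inj₂ _) = true
Ktt t (inj₂ _) (inj₁ _) = true
Ktt t _ _ = false

WeaklySparse : GraphPred → Set
WeaklySparse X = Σ ℕ λ t → ∀ n (G : Graph (Fin n)) → X G → ¬ (_⊆ᵍ_ {Fin t ⊎ Fin t} {Fin n} (Ktt t) (adj G))

Edge : ∀ {n} → Graph (Fin n) → Set
Edge {n} G = Σ (Fin n × Fin n) λ p → (proj₁ p F.< proj₂ p) × T (adj G (proj₁ p) (proj₂ p))

src tgt : ∀ {n} {G : Graph (Fin n)} → Edge G → Fin n
src e = proj₁ (proj₁ e)
tgt e = proj₂ (proj₁ e)

eqFin : ∀ {n} → Fin n → Fin n → Bool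
eqFin a b = ⌊ a ≟ b ⌋

isZero : ℕ → Bool
isZero zero = true
isZero (suc _) = false

SubdivV : ∀ {n} → Graph (Fin n) → ℕ → Set
SubdivV {n} G r = Fin n ⊎ (Edge G × Fin r)

-- one orientation of the adjacency of the r-subdivision; for edge e = uv (u<v)
-- the path is u, (e,0), (e,1), ..., (e,r-1), v  (for r = 0 it is the edge uv itself)
subdivAdj₀ : ∀ {n} (G : Graph (Fin n)) (r : ℕ) → SubdivV G r → SubdivV G r → Bool
subdivAdj₀ G r (inj₁ a) (inj₁ b) = isZero r ∧ adj G a b
subdivAdj₀ G r (inj₁ a) (inj₂ (e , k)) =
  (eqFin a (src {G = G} e) ∧ (toℕ k ≡ᵇ 0)) ∨ (eqFin a (tgt {G = G} e) ∧ (suc (toℕ k) ≡ᵇ r))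
subdivAdj₀ G r (inj₂ _) (inj₁ _) = false
subdivAdj₀ G r (inj₂ (e , k)) (inj₂ (e' , k')) =
  eqFin (src {G = G} e) (src {G = G} e') ∧ eqFin (tgt {G = G} e) (tgt {G = G} e') ∧ (suc (toℕ k) ≡ᵇ toℕ k')

subdivAdj : ∀ {n} (G : Graph (Fin n)) (r : ℕ) → SubdivV G r → SubdivV G r → Bool
subdivAdj G r x y = subdivAdj₀ G r x y ∨ subdivAdj₀ G r y x

degSum : ∀ {n} → Graph (Fin n) → ℕ
degSum {n} G = sum (map (λ u → length (filter (λ v → T? (adj G u v)) (allFinL n))) (allFinL n))
  where
  open import Data.Bool.Properties using (T?)

AvgDegGt : ∀ {n} → Graph (Fin n) → ℕ → Set
AvgDegGt {n} G d = d * n < degSum G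

BoundedExpansion : GraphPred → Set
BoundedExpansion X = Σ (ℕ → ℕ) λ f → ∀ (r : ℕ) {n} (G : Graph (Fin n)) → AvgDegGt G (f r) →
  ∀ {m} (H : Graph (Fin m)) → X H → ¬ (_⊆ᵍ_ {SubdivV G r} {Fin m} (subdivAdj G r) (adj H))

{-# OPTIONS --safe #-}

-- Count labelled induced subgraphs: a graph of the class containing a dense r-subdivision has, for some k,
-- more than k! cᵏ of them.  View the subdivision as a (hyper)graph whose vertices are branch vertices and whose
-- edges are links (subdivided edges; for r = 0, low-degree vertices with t + 1 chosen neighbours in a small
-- set A).  Pass to a minimal subhypergraph in which every vertex lies in at least D links.  Deleting one link
-- makes it peel completely, each vertex being removed when fewer than D links are left at it, so every vertex
-- is joined to an earlier one by a link and fewer than D links have a given earliest end.  Hence, whatever the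
-- degrees, the labels of N branch vertices and of N tree links can be recovered from the labelled graph and
-- O(N log D) bits.  The other links, about D N / t of them, can be kept or dropped: choosing one link from each
-- of μ N blocks of a large constant size s gives s^(μ N) subgraphs, and a kept link is recovered at constant
-- cost (r = 0: fewer than t candidates, as there is no K_{t,t}; r ≥ 1: along the path, whose vertices have
-- bounded degree by the case r = 0).  With μ of order log D this beats c^k.
module Submission where

open import Defs renaming (sym to adj-sym)

open import Data.Bool.Base using (Bool; true; false; _∧_; _∨_; not; T; if_then_else_)
import Data.Bool.Properties as Bool
open import Data.Empty using (⊥)
open import Data.Fin.Base using (Fin; zero; suc; toℕ; fromℕ; fromℕ<; inject₁; inject≤; punchIn; _↑ˡ_; _↑ʳ_; combine; remQuot; finToFun; funToFin)
open import Data.Fin.Induction using (<-weakInduction)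
open import Data.Fin.Permutation as Perm using (Permutation′; _⟨$⟩ʳ_; _⟨$⟩ˡ_; inverseˡ; inverseʳ)
open import Data.Fin.Properties using (_≟_; any?; all?; toℕ-injective; toℕ<n; toℕ-fromℕ; toℕ-fromℕ<; toℕ-inject₁; suc-injective; inject₁-injective; inject≤-injective; punchIn-injective; combine-injective; combine-remQuot; remQuot-combine; funToFin-finToFin; finToFun-funToFin; injective⇒≤; +↔⊎; *↔×)
open import Data.List.Base using (List; []; _∷_; length; lookup; map; filter; tabulate)
open import Data.List.Membership.Propositional using (_∈_)
open import Data.List.Membership.Propositional.Properties using (∈-lookup)
open import Data.List.Properties using (length-tabulate)
import Data.List.Relation.Unary.All as All
import Data.List.Relation.Unary.All.Properties as All
open import Data.List.Relation.Unary.AllPairs using (AllPairs; []; _∷_)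
import Data.List.Relation.Unary.AllPairs.Properties as AllPairs
open import Data.List.Relation.Unary.Any using (here; there; index)
open import Data.List.Relation.Unary.Any.Properties using (lookup-index)
open import Data.List.Relation.Unary.Unique.Propositional using (Unique)
open import Data.Nat.Base using (ℕ; zero; suc; _+_; _*_; _∸_; _^_; _!; _≤_; _<_; z≤n; s≤s; s≤s⁻¹; NonZero; >-nonZero; _≡ᵇ_)
open import Data.Nat.Induction using (<-rec)
import Data.Nat.ListAction as List
open import Data.Nat.Properties as ℕ hiding (_≟_; suc-injective)
open import Data.Nat.Solver using (module +-*-Solver)
open import Data.Product.Base using (∃; _×_; _,_; proj₁; proj₂; uncurry)
open import Data.Sum.Base using (_⊎_; inj₁; inj₂)
open import Data.Sum.Function.Propositional using (_⊎-↔_)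
open import Data.Sum.Properties using (inj₁-injective; inj₂-injective)
open import Function.Base using (_∘_)
open import Function.Bundles using (_↔_; mk⇔; Inverse)
open import Function.Definitions using (Injective)
open import Function.Properties.Inverse using (↔-refl; ↔-trans)
open import Relation.Binary.PropositionalEquality
open import Relation.Nullary using (Dec; yes; no; does; ¬_; contradiction; _×-dec_; _⊎-dec_; _→-dec_)
open import Relation.Nullary.Decidable using (dec-true; dec-false; does-⇔; isYes≗does)
open import Algebra.Properties.Semiring.Sum +-*-semiring using (sum; sum-cong-≗; sum-remove; ∑-comm; ∑-distrib-+; *-distribˡ-sum)

-- Finite sums and subsets (Boolean functions) of Fin n

-- A label is cheap to recover only if something visible in the labelled graph leaves few candidates
-- for it. Branch vertices may have unbounded degree, so no pointer may start at one; pointers start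
-- at links or at path vertices, whose rows are short, and the parent and the tag of a tree link are
-- stored with the link itself.
--
-- The constants are chosen in a fixed order. The block size s depends only on c, t, ρ and a degree
-- bound, and absorbs every cost that is exponential in the number of labels, which leaves a gain
-- 2^μ per branch vertex. D has to be a multiple of μ merely because the core must hold N tree links
-- and μ N blocks of size s; for r = 0 the degree bound Δ is in turn a multiple of D. The tree cost
-- per branch vertex is therefore polynomial in μ, and a large μ finishes.
--
-- For r ≥ 1 the subdivision need not be induced: its path vertices may have many further neighbours
-- inside it. A bound on the number of edges, which is the case r = 0, is what makes most paths
-- consist of vertices of low degree.

sum-mono : ∀ {n} (f g : Fin n → ℕ) → (∀ i → f i ≤ g i) → sum f ≤ sum g
sum-mono {zero}  f g h = z≤n
sum-mono {suc n} f g h = +-mono-≤ (h zero) (sum-mono (f ∘ suc) (g ∘ suc) (h ∘ suc))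

sum-const : ∀ n c → sum {n} (λ _ → c) ≡ n * c
sum-const zero    c = refl
sum-const (suc n) c = cong (c +_) (sum-const n c)

term≤sum : ∀ {n} (f : Fin n → ℕ) i → f i ≤ sum f
term≤sum f zero    = m≤m+n _ _
term≤sum f (suc i) = ≤-trans (term≤sum (f ∘ suc) i) (m≤n+m _ (f zero))

exceeds-average : ∀ {n} c (f : Fin n → ℕ) → n * c < sum f → ∃ λ i → c < f i
exceeds-average {n} c f h with any? (λ i → c <? f i)
... | yes p = p
... | no ¬p = contradiction h (≤⇒≯ (≤-trans (sum-mono f (λ _ → c) (λ i → ≮⇒≥ (λ lt → ¬p (i , lt)))) (≤-reflexive (sum-const n c))))

b2n : Bool → ℕ
b2n true  = 1
b2n false = 0

b2n≤1 : ∀ b → b2n b ≤ 1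
b2n≤1 true  = ≤-refl
b2n≤1 false = z≤n

count : ∀ {n} → (Fin n → Bool) → ℕ
count f = sum (b2n ∘ f)

_⊖_ : ∀ {n} → (Fin n → Bool) → Fin n → Fin n → Bool
(f ⊖ i) j = f j ∧ not (does (i ≟ j))

∧-trueˡ : ∀ {a b} → a ∧ b ≡ true → a ≡ true
∧-trueˡ {true} _ = refl

∧-trueʳ : ∀ {a b} → a ∧ b ≡ true → b ≡ true
∧-trueʳ {true} p = p

∧-true : ∀ {a b} → a ≡ true → b ≡ true → a ∧ b ≡ true
∧-true refl refl = refl

does-true : ∀ {P : Set} (d : Dec P) → does d ≡ true → P
does-true (yes p) _ = p

does-false : ∀ {P : Set} (d : Dec P) → does d ≡ false → ¬ P
does-false (no ¬p) _ = ¬p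

not-true : ∀ {b} → not b ≡ true → b ≡ false
not-true {false} _ = refl

true≢false : ∀ {b} → b ≡ true → b ≡ false → ⊥
true≢false refl ()

⊖-true : ∀ {n} {f : Fin n → Bool} {i j} → f j ≡ true → i ≢ j → (f ⊖ i) j ≡ true
⊖-true {i = i} {j} p q = ∧-true p (cong not (dec-false (i ≟ j) q))

⊖-≢ : ∀ {n} {f : Fin n → Bool} {i j} → (f ⊖ i) j ≡ true → i ≢ j
⊖-≢ {f = f} {i} {j} p = does-false (i ≟ j) (not-true (∧-trueʳ {f j} p))

b2n-mono : ∀ {a b} → (a ≡ true → b ≡ true) → b2n a ≤ b2n b
b2n-mono {false}        h = z≤n
b2n-mono {true} {true}  h = ≤-refl
b2n-mono {true} {false} h = contradiction (h refl) λ ()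

count-mono : ∀ {n} (f g : Fin n → Bool) → (∀ i → f i ≡ true → g i ≡ true) → count f ≤ count g
count-mono f g h = sum-mono (b2n ∘ f) (b2n ∘ g) (λ i → b2n-mono (h i))

count-cong : ∀ {n} (f g : Fin n → Bool) → f ≗ g → count f ≡ count g
count-cong f g h = sum-cong-≗ {x = b2n ∘ f} {y = b2n ∘ g} (λ i → cong b2n (h i))

count-all : ∀ n → count {n} (λ _ → true) ≡ n
count-all n = trans (sum-const n 1) (*-identityʳ n)

count≤n : ∀ {n} (f : Fin n → Bool) → count f ≤ n
count≤n {n} f = ≤-trans (count-mono f (λ _ → true) (λ _ _ → refl)) (≤-reflexive (count-all n))

count-pos : ∀ {n} (f : Fin n → Bool) i → f i ≡ true → 1 ≤ count f
count-pos f i p = ≤-trans (≤-reflexive (sym (cong b2n p))) (term≤sum (b2n ∘ f) i)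

count-witness : ∀ {n} (f : Fin n → Bool) → 1 ≤ count f → ∃ λ i → f i ≡ true
count-witness {suc n} f h with f zero in eq
... | true  = zero , eq
... | false with i , p ← count-witness (f ∘ suc) h = suc i , p

count-⊖ : ∀ {n} (f : Fin n → Bool) i → f i ≡ true → count f ≡ suc (count (f ⊖ i))
count-⊖ {suc n} f zero p rewrite p =
  cong suc (count-cong (f ∘ suc) ((f ⊖ zero) ∘ suc) (λ j → sym (∧-identityʳ′ (f (suc j)))))
  where
  ∧-identityʳ′ : ∀ b → b ∧ true ≡ b
  ∧-identityʳ′ true  = refl
  ∧-identityʳ′ false = refl
count-⊖ {suc n} f (suc i) p with f zero
... | true  = cong suc (count-⊖ (f ∘ suc) i p)
... | false = count-⊖ (f ∘ suc) i p

b2n-split : ∀ a b → b2n a ≡ b2n (a ∧ b) + b2n (a ∧ not b)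
b2n-split true true   = refl
b2n-split true false  = refl
b2n-split false _     = refl

count-split : ∀ {n} (f g : Fin n → Bool) → count f ≡ count (λ i → f i ∧ g i) + count (λ i → f i ∧ not (g i))
count-split f g = trans (sum-cong-≗ (λ i → b2n-split (f i) (g i)))
  (∑-distrib-+ (λ i → b2n (f i ∧ g i)) (λ i → b2n (f i ∧ not (g i))))

count-injective : ∀ {a b} (p : Fin a → Bool) (q : Fin b → Bool) (g : ∀ i → p i ≡ true → Fin b) →
  (∀ i j pi pj → g i pi ≡ g j pj → i ≡ j) →
  (∀ i pi → q (g i pi) ≡ true) → count p ≤ count q
count-injective {zero}  p q g inj h = z≤n
count-injective {suc a} p q g inj h with p zero in eq
... | false = count-injective (p ∘ suc) q (g ∘ suc)
                (λ i j pi pj e → suc-injective (inj (suc i) (suc j) pi pj e)) (λ i → h (suc i))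
... | true  = ≤-trans (s≤s (count-injective (p ∘ suc) (q ⊖ g zero eq) (g ∘ suc)
                (λ i j pi pj e → suc-injective (inj (suc i) (suc j) pi pj e))
                (λ i pi → ⊖-true {f = q} (h (suc i) pi) (λ e → contradiction (inj zero (suc i) eq pi e) λ ()))))
                (≤-reflexive (sym (count-⊖ q (g zero eq) (h zero eq))))

enum : ∀ {n} (f : Fin n → Bool) → Fin (count f) → Fin n
enum {suc n} f x with f zero
enum {suc n} f zero    | true  = zero
enum {suc n} f (suc x) | true  = suc (enum (f ∘ suc) x)
enum {suc n} f x       | false = suc (enum (f ∘ suc) x)

enum-true : ∀ {n} (f : Fin n → Bool) x → f (enum f x) ≡ true
enum-true {suc n} f x with f zero in eq
enum-true {suc n} f zero    | true  = eq
enum-true {suc n} f (suc x) | true  = enum-true (f ∘ suc) x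
enum-true {suc n} f x       | false = enum-true (f ∘ suc) x

enum-injective : ∀ {n} (f : Fin n → Bool) x y → enum f x ≡ enum f y → x ≡ y
enum-injective {suc n} f x y e with f zero
enum-injective {suc n} f zero zero e       | true = refl
enum-injective {suc n} f (suc x) (suc y) e | true = cong suc (enum-injective (f ∘ suc) x y (suc-injective e))
enum-injective {suc n} f x y e             | false = enum-injective (f ∘ suc) x y (suc-injective e)

enum-surjective : ∀ {n} (f : Fin n → Bool) i → f i ≡ true → ∃ λ x → enum f x ≡ i
enum-surjective {suc n} f i p with f zero in eq
enum-surjective {suc n} f zero p    | true  = zero , refl
enum-surjective {suc n} f (suc i) p | true  with x , e ← enum-surjective (f ∘ suc) i p = suc x , cong suc e
enum-surjective {suc n} f zero p    | false = contradiction (trans (sym eq) p) λ ()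
enum-surjective {suc n} f (suc i) p | false with x , e ← enum-surjective (f ∘ suc) i p = x , cong suc e

rank : ∀ {n} → (Fin n → Bool) → Fin n → ℕ
rank f zero    = 0
rank f (suc i) = b2n (f zero) + rank (f ∘ suc) i

rank<count : ∀ {n} (f : Fin n → Bool) i → f i ≡ true → rank f i < count f
rank<count f zero    p rewrite p = s≤s z≤n
rank<count f (suc i) p = +-monoʳ-< (b2n (f zero)) (rank<count (f ∘ suc) i p)

rank-injective : ∀ {n} (f : Fin n → Bool) i j → f i ≡ true → f j ≡ true → rank f i ≡ rank f j → i ≡ j
rank-injective f zero    zero    p q e = refl
rank-injective f zero    (suc j) p q e rewrite p = contradiction e λ ()
rank-injective f (suc i) zero    p q e rewrite q = contradiction e λ ()
rank-injective f (suc i) (suc j) p q e =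
  cong suc (rank-injective (f ∘ suc) i j p q (+-cancelˡ-≡ (b2n (f zero)) _ _ e))

rank-cong : ∀ {n} {f g : Fin n → Bool} → f ≗ g → ∀ i → rank f i ≡ rank g i
rank-cong h zero    = refl
rank-cong h (suc i) = cong₂ _+_ (cong b2n (h zero)) (rank-cong (h ∘ suc) i)

-- Out-of-range values are sent to the junk value zero, so that codes need no side conditions.
clamp : ∀ b → ℕ → Fin (suc b)
clamp b n with n <? suc b
... | yes n<b = fromℕ< n<b
... | no  _   = zero

clamp-injective : ∀ {b m n} → m ≤ b → n ≤ b → clamp b m ≡ clamp b n → m ≡ n
clamp-injective {b} {m} {n} m≤b n≤b e with m <? suc b | n <? suc b
... | yes p | yes q = trans (sym (toℕ-fromℕ< p)) (trans (cong toℕ e) (toℕ-fromℕ< q))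
... | yes _ | no ¬q = contradiction (s≤s n≤b) ¬q
... | no ¬p | _     = contradiction (s≤s m≤b) ¬p

pointer : ∀ {n} b → (Fin n → Bool) → Fin n → Fin (suc b)
pointer b f i = clamp b (rank f i)

-- The basic decoding step: the labelled graph shows the same set `f` ≗ `g` of possible labels in
-- both configurations, so the rank alone, one of `b` + 1 values, identifies the label.
pointer-injective : ∀ {n} b {f g : Fin n → Bool} {i j} → f ≗ g → count f ≤ b →
  f i ≡ true → g j ≡ true → pointer b f i ≡ pointer b g j → i ≡ j
pointer-injective b {f} {g} {i} {j} f≗g cf fi gj e =
  rank-injective f i j fi fj (clamp-injective (bound fi) (bound fj)
    (trans e (cong (clamp b) (sym (rank-cong f≗g j)))))
  where
  fj = trans (f≗g j) gj
  bound : ∀ {i} → f i ≡ true → rank f i ≤ b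
  bound {i} p = ≤-trans (<⇒≤ (rank<count f i p)) cf

-- Enumeration of functions and permutations

finToFun-injective : ∀ {m n} (x y : Fin (m ^ n)) → finToFun {m} {n} x ≗ finToFun y → x ≡ y
finToFun-injective {m} {n} x y h = begin
  x                               ≡⟨ sym (funToFin-finToFin {n} {m} x) ⟩
  funToFin (finToFun {m} {n} x)   ≡⟨ funToFin-cong h ⟩
  funToFin (finToFun {m} {n} y)   ≡⟨ funToFin-finToFin {n} {m} y ⟩
  y                               ∎
  where
  open ≡-Reasoning
  funToFin-cong : ∀ {m n} {f g : Fin m → Fin n} → f ≗ g → funToFin f ≡ funToFin g
  funToFin-cong {zero}  h = refl
  funToFin-cong {suc m} h = cong₂ combine (h zero) (funToFin-cong (h ∘ suc))

funToFin-injective : ∀ {m n} {f g : Fin m → Fin n} → funToFin f ≡ funToFin g → f ≗ g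
funToFin-injective {f = f} {g} e i =
  trans (sym (finToFun-funToFin f i)) (trans (cong (λ x → finToFun x i) e) (finToFun-funToFin g i))

remQuot-injective : ∀ {n} k (x y : Fin (n * k)) → remQuot {n} k x ≡ remQuot k y → x ≡ y
remQuot-injective {n} k x y e =
  trans (sym (combine-remQuot {n} k x)) (trans (cong (uncurry combine) e) (combine-remQuot {n} k y))

-- The factorial number system: the leading digit is the image of `zero`, the other digits code the
-- permutation of what remains.
perm : ∀ n → Fin (n !) → Permutation′ n
perm zero    _ = Perm.id
perm (suc n) x = Perm.insert zero (proj₁ (remQuot {suc n} (n !) x)) (perm n (proj₂ (remQuot {suc n} (n !) x)))

perm-injective : ∀ n x y → (∀ i → perm n x ⟨$⟩ʳ i ≡ perm n y ⟨$⟩ʳ i) → x ≡ y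
perm-injective zero    zero zero h = refl
perm-injective (suc n) x y h = remQuot-injective {suc n} (n !) x y
  (cong₂ _,_ (h zero) (perm-injective n _ _ λ i → punchIn-injective _ _ _
    (trans (h (suc i)) (cong (λ z → punchIn z _) (sym (h zero))))))

⟨$⟩ʳ-injective : ∀ {n} (τ : Permutation′ n) {i j} → τ ⟨$⟩ʳ i ≡ τ ⟨$⟩ʳ j → i ≡ j
⟨$⟩ʳ-injective τ e = trans (sym (inverseˡ τ)) (trans (cong (τ ⟨$⟩ˡ_) e) (inverseˡ τ))

-- Counting labelled induced subgraphs

HasSpeed : GraphPred → ℕ → Set
HasSpeed X c = ∀ n (L : List (Graph (Fin n))) → All.All X L → AllPairs (λ G H → ¬ SameGraph G H) L → length L ≤ (n !) * c ^ n

-- Graphs in one fibre of `enc` are pairwise distinct members of the class, so each of the `R`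
-- fibres has at most k! c^k elements.
codes-bound : (X : GraphPred) (c : ℕ) → HasSpeed X c → ∀ {K R k} (enc : Fin K → Fin R)
  (gr : Fin K → Graph (Fin k)) → (∀ x → X (gr x)) →
  (∀ x y → enc x ≡ enc y → SameGraph (gr x) (gr y) → x ≡ y) → K ≤ R * ((k !) * c ^ k)
codes-bound X c speed {K} {R} {k} enc gr inX decode = begin
  K                                                       ≡⟨ trans (sym (*-identityʳ K)) (sym (sum-const K 1)) ⟩
  sum {K} (λ _ → 1)                                       ≤⟨ sum-mono {K} (λ _ → 1) _ one ⟩
  sum {K} (λ x → sum {R} (λ r → hit x r))                 ≡⟨ ∑-comm hit ⟩
  sum {R} (λ r → sum {K} (λ x → hit x r))                 ≤⟨ sum-mono {R} _ (λ _ → (k !) * c ^ k) fibre ⟩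
  sum {R} (λ _ → (k !) * c ^ k)                           ≡⟨ sum-const R _ ⟩
  R * ((k !) * c ^ k)                                     ∎
  where
  open ≤-Reasoning
  hit : Fin K → Fin R → ℕ
  hit x r = b2n (does (enc x ≟ r))
  one : ∀ x → 1 ≤ sum (hit x)
  one x = ≤-trans (≤-reflexive (sym (cong b2n (dec-true (enc x ≟ enc x) refl)))) (term≤sum (hit x) (enc x))
  fibre : ∀ r → sum (λ x → hit x r) ≤ (k !) * c ^ k
  fibre r = subst (_≤ (k !) * c ^ k) (length-tabulate (gr ∘ enum p))
    (speed k (tabulate (gr ∘ enum p)) (All.tabulate⁺ (λ x → inX (enum p x)))
      (AllPairs.tabulate⁺ {f = gr ∘ enum p} λ {i} {j} i≢j same → i≢j (enum-injective p i j
        (decode _ _ (trans (at i) (sym (at j))) same))))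
    where
    p : Fin K → Bool
    p x = does (enc x ≟ r)
    at : ∀ i → enc (enum p i) ≡ r
    at i = does-true (enc (enum p i) ≟ r) (enum-true p i)

-- A labelled induced subgraph on N branch vertices, N' tree links and M further links, `pick` taking the q-th of
-- the latter from a block of s links; a link has ρ vertices.  Each kind of vertex has its own set of labels
-- (one kind for each position on a link), which costs only an exponential factor, see `!-parts`.
record Config (N N' M s ρ : ℕ) : Set where
  field
    π : Permutation′ N
    κ : Fin ρ → Permutation′ N'
    σ : Fin ρ → Permutation′ M
    pick : Fin M → Fin s
open Config public

-- Agreement of values: permutations that agree everywhere need not be propositionally equal.
record _≈_ {N N' M s ρ} (C C' : Config N N' M s ρ) : Set where
  field
    π≈ : ∀ a → π C ⟨$⟩ʳ a ≡ π C' ⟨$⟩ʳ a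
    κ≈ : ∀ j p → κ C j ⟨$⟩ʳ p ≡ κ C' j ⟨$⟩ʳ p
    σ≈ : ∀ j q → σ C j ⟨$⟩ʳ q ≡ σ C' j ⟨$⟩ʳ q
    pick≈ : ∀ q → pick C q ≡ pick C' q
open _≈_ public

module _ {N N' M s ρ : ℕ} where

  #configs : ℕ
  #configs = N ! * ((N' !) ^ ρ * ((M !) ^ ρ * s ^ M))

  private
    split₁ : Fin #configs → Fin (N !) × Fin ((N' !) ^ ρ * ((M !) ^ ρ * s ^ M))
    split₁ = remQuot _
    split₂ : Fin ((N' !) ^ ρ * ((M !) ^ ρ * s ^ M)) → Fin ((N' !) ^ ρ) × Fin ((M !) ^ ρ * s ^ M)
    split₂ = remQuot _
    split₃ : Fin ((M !) ^ ρ * s ^ M) → Fin ((M !) ^ ρ) × Fin (s ^ M)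
    split₃ = remQuot _

  config : Fin #configs → Config N N' M s ρ
  config x = record
    { π = perm N (proj₁ (split₁ x))
    ; κ = λ j → perm N' (finToFun (proj₁ (split₂ (proj₂ (split₁ x)))) j)
    ; σ = λ j → perm M (finToFun (proj₁ (split₃ (proj₂ (split₂ (proj₂ (split₁ x)))))) j)
    ; pick = finToFun (proj₂ (split₃ (proj₂ (split₂ (proj₂ (split₁ x))))))
    }

  config-injective : ∀ x y → config x ≈ config y → x ≡ y
  config-injective x y e = remQuot-injective {N !} _ x y (cong₂ _,_ (perm-injective N _ _ (π≈ e))
    (remQuot-injective {(N' !) ^ ρ} _ _ _ (cong₂ _,_
      (finToFun-injective {N' !} {ρ} _ _ λ j → perm-injective N' _ _ (κ≈ e j))
      (remQuot-injective {(M !) ^ ρ} _ _ _ (cong₂ _,_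
        (finToFun-injective {M !} {ρ} _ _ λ j → perm-injective M _ _ (σ≈ e j))
        (finToFun-injective {s} {M} _ _ (pick≈ e)))))))

  Point Label : Set
  Point = Fin N ⊎ ((Fin ρ × Fin N') ⊎ (Fin ρ × (Fin M × Fin s)))
  Label = Fin N ⊎ ((Fin ρ × Fin N') ⊎ (Fin ρ × Fin M))

  place : Config N N' M s ρ → Label → Point
  place C (inj₁ a)              = inj₁ (π C ⟨$⟩ʳ a)
  place C (inj₂ (inj₁ (j , p))) = inj₂ (inj₁ (j , κ C j ⟨$⟩ʳ p))
  -- The choice belongs to the block and not to the label, so the ρ positions of a link, labelled by
  -- unrelated permutations, lie on the same chosen link.
  place C (inj₂ (inj₂ (j , q))) = inj₂ (inj₂ (j , (σ C j ⟨$⟩ʳ q , pick C (σ C j ⟨$⟩ʳ q))))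

  place-injective : ∀ C → Injective _≡_ _≡_ (place C)
  place-injective C {inj₁ a} {inj₁ b} e = cong inj₁ (⟨$⟩ʳ-injective (π C) (inj₁-injective e))
  place-injective C {inj₂ (inj₁ (j , p))} {inj₂ (inj₁ (j' , p'))} e
    with inj₁-injective (inj₂-injective e)
  ... | e' with refl ← cong proj₁ e' = cong (λ z → inj₂ (inj₁ (j , z))) (⟨$⟩ʳ-injective (κ C j) (cong proj₂ e'))
  place-injective C {inj₂ (inj₂ (j , p))} {inj₂ (inj₂ (j' , p'))} e
    with inj₂-injective (inj₂-injective e)
  ... | e' with refl ← cong proj₁ e' = cong (λ z → inj₂ (inj₂ (j , z))) (⟨$⟩ʳ-injective (σ C j) (cong (proj₁ ∘ proj₂) e'))
  place-injective C {inj₁ _} {inj₂ (inj₁ _)} ()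
  place-injective C {inj₁ _} {inj₂ (inj₂ _)} ()
  place-injective C {inj₂ (inj₁ _)} {inj₁ _} ()
  place-injective C {inj₂ (inj₂ _)} {inj₁ _} ()
  place-injective C {inj₂ (inj₁ _)} {inj₂ (inj₂ _)} ()
  place-injective C {inj₂ (inj₂ _)} {inj₂ (inj₁ _)} ()

  #labels : ℕ
  #labels = N + (ρ * N' + ρ * M)

  labels : Fin #labels ↔ Label
  labels = ↔-trans +↔⊎ (↔-refl ⊎-↔ ↔-trans +↔⊎ (*↔× ⊎-↔ *↔×))

  SamePattern : ∀ {m} → Graph (Fin m) → (Point → Fin m) → (C C' : Config N N' M s ρ) → Set
  SamePattern H emb C C' = ∀ u v →
    adj H (emb (place C u)) (emb (place C v)) ≡ adj H (emb (place C' u)) (emb (place C' v))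

  -- `Hereditary` admits arbitrary injections, so a single use along `ι` both restricts to the
  -- chosen vertices and labels them.
  configs-bound : (X : GraphPred) (c : ℕ) → Hereditary X → HasSpeed X c →
    ∀ {m} (H : Graph (Fin m)) → X H → (emb : Point → Fin m) → Injective _≡_ _≡_ emb →
    ∀ {R} (enc : Config N N' M s ρ → Fin R) →
    (∀ C C' → enc C ≡ enc C' → SamePattern H emb C C' → C ≈ C') →
    #configs ≤ R * ((#labels !) * c ^ #labels)
  configs-bound X c her speed H XH emb emb-inj enc decode =
    codes-bound X c speed (enc ∘ config) (λ x → induced H (ι x))
      (λ x → her H (ι x) (λ {i} {j} → ι-inj x {i} {j}) XH)
      (λ x y e same → config-injective x y (decode (config x) (config y) e (pattern-of same)))
    where
    open Inverse labels using (to; from; strictlyInverseˡ; strictlyInverseʳ)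
    ι : Fin #configs → Fin #labels → Fin _
    ι x l = emb (place (config x) (to l))
    ι-inj : ∀ x → Injective _≡_ _≡_ (ι x)
    ι-inj x {i} {j} e = trans (sym (strictlyInverseʳ i))
      (trans (cong from (place-injective (config x) (emb-inj e))) (strictlyInverseʳ j))
    pattern-of : ∀ {x y} → SameGraph (induced H (ι x)) (induced H (ι y)) → SamePattern H emb (config x) (config y)
    pattern-of {x} {y} same u v with same (from u) (from v)
    ... | e rewrite strictlyInverseˡ u | strictlyInverseˡ v = e

-- The peeling tree: `conn i` links vertex i to the earlier vertex `par (conn i)`,
-- and `tag` tells apart the links with the same parent (`zero` marks the root link).
record Tree (N N' Δ t : ℕ) : Set where
  field
    inc           : Fin N' → Fin N → Bool
    par         : Fin N' → Fin N
    tag         : Fin N' → Fin (suc t)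
    conn        : Fin N → Fin N'
    inc-count     : ∀ β → count (inc β) ≤ Δ
    inc-par       : ∀ β → inc β (par β) ≡ true
    inc-conn      : ∀ i → inc (conn i) i ≡ true
    root-unique : ∀ β β' → tag β ≡ zero → tag β' ≡ zero → β ≡ β'
    tag-unique  : ∀ β β' → par β ≡ par β' → tag β ≡ tag β' → β ≡ β'
    par<        : ∀ i → tag (conn i) ≢ zero → toℕ (par (conn i)) < toℕ i

module TreeCode {N N' Δ t : ℕ} (𝒯 : Tree N N' Δ t) where
  open Tree 𝒯

  -- Incidence in terms of labels. This is all that the decoder sees of the tree.
  row : Permutation′ N → Permutation′ N' → Fin N' → Fin N → Bool
  row τ υ p a = inc (υ ⟨$⟩ʳ p) (τ ⟨$⟩ʳ a)

  parentCode : Permutation′ N → Permutation′ N' → Fin N' → Fin (suc Δ)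
  parentCode τ υ p = pointer Δ (row τ υ p) (τ ⟨$⟩ˡ par (υ ⟨$⟩ʳ p))

  linkCode : Permutation′ N → Permutation′ N' → Fin N' → Fin (suc Δ * suc t)
  linkCode τ υ p = combine (parentCode τ υ p) (tag (υ ⟨$⟩ʳ p))

  childCode : Permutation′ N → Permutation′ N' → Fin N → Fin (suc Δ)
  childCode τ υ i = pointer Δ (row τ υ (υ ⟨$⟩ˡ conn i)) (τ ⟨$⟩ˡ i)

  -- Links are coded by label, vertices by their place in the tree. The tree itself is fixed, so the
  -- decoder can walk along it and ask for the label of each vertex in turn.
  treeCode : Permutation′ N → Permutation′ N' → Fin ((suc Δ * suc t) ^ N' * suc Δ ^ N)
  treeCode τ υ = combine (funToFin (linkCode τ υ)) (funToFin (childCode τ υ))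

  module _ (τ τ' : Permutation′ N) (υ υ' : Permutation′ N')
           (rows : ∀ p a → row τ υ p a ≡ row τ' υ' p a)
           (codes : treeCode τ υ ≡ treeCode τ' υ') where

    private
      halves : funToFin (linkCode τ υ) ≡ funToFin (linkCode τ' υ') × funToFin (childCode τ υ) ≡ funToFin (childCode τ' υ')
      halves = combine-injective (funToFin (linkCode τ υ)) (funToFin (childCode τ υ)) _ _ codes

      child : ∀ i → childCode τ υ i ≡ childCode τ' υ' i
      child = funToFin-injective (proj₂ halves)

      link : ∀ p → parentCode τ υ p ≡ parentCode τ' υ' p × tag (υ ⟨$⟩ʳ p) ≡ tag (υ' ⟨$⟩ʳ p)
      link p = combine-injective (parentCode τ υ p) _ (parentCode τ' υ' p) _ (funToFin-injective (proj₁ halves) p)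

      row-count : ∀ p → count (row τ υ p) ≤ Δ
      row-count p = ≤-trans (count-injective _ (inc (υ ⟨$⟩ʳ p)) (λ a _ → τ ⟨$⟩ʳ a)
        (λ i j _ _ e → ⟨$⟩ʳ-injective τ e) (λ _ h → h)) (inc-count _)

      row-at : ∀ τ υ p a → inc (υ ⟨$⟩ʳ p) a ≡ true → row τ υ p (τ ⟨$⟩ˡ a) ≡ true
      row-at τ υ p a h = trans (cong (inc (υ ⟨$⟩ʳ p)) (inverseʳ τ)) h

      -- The code attaches to the label of `β` its tag and the label of its parent. If the parent
      -- bears the same label on both sides, the link with this label on the other side has the same
      -- parent and tag, hence is `β`; the root is recognised by its tag.
      links-agree : ∀ β → (tag β ≢ zero → τ ⟨$⟩ˡ par β ≡ τ' ⟨$⟩ˡ par β) → υ' ⟨$⟩ʳ (υ ⟨$⟩ˡ β) ≡ β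
      links-agree β h = go (tag β ≟ zero)
        where
        p  = υ ⟨$⟩ˡ β
        β' = υ' ⟨$⟩ʳ p
        β≡ : υ ⟨$⟩ʳ p ≡ β
        β≡ = inverseʳ υ
        same-tag : tag β' ≡ tag β
        same-tag = trans (sym (proj₂ (link p))) (cong tag β≡)
        go : Dec (tag β ≡ zero) → β' ≡ β
        go (yes r) = root-unique β' β (trans same-tag r) r
        go (no ¬r) = tag-unique β' β (trans (sym (inverseʳ τ')) (trans (cong (τ' ⟨$⟩ʳ_) (sym e)) (inverseʳ τ'))) same-tag
          where
          e : τ' ⟨$⟩ˡ par β ≡ τ' ⟨$⟩ˡ par β'
          e = trans (sym (h ¬r)) (trans (cong (λ z → τ ⟨$⟩ˡ par z) (sym β≡))
                (pointer-injective Δ (rows p) (row-count p)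
                  (row-at τ υ p (par (υ ⟨$⟩ʳ p)) (inc-par _)) (row-at τ' υ' p (par β') (inc-par _)) (proj₁ (link p))))

      to-labels : ∀ β → υ' ⟨$⟩ʳ (υ ⟨$⟩ˡ β) ≡ β → υ ⟨$⟩ˡ β ≡ υ' ⟨$⟩ˡ β
      to-labels β e = trans (sym (inverseˡ υ')) (cong (υ' ⟨$⟩ˡ_) e)

      -- Induction along the peeling order: the parent of `conn i` comes before i, so the label of
      -- `conn i` is known, and the child code picks i from the row of that link.
      vertices : ∀ n i → toℕ i ≡ n → τ ⟨$⟩ˡ i ≡ τ' ⟨$⟩ˡ i
      vertices = <-rec _ step
        where
        step : ∀ n → (∀ {m} → m < n → ∀ i → toℕ i ≡ m → τ ⟨$⟩ˡ i ≡ τ' ⟨$⟩ˡ i) →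
               ∀ i → toℕ i ≡ n → τ ⟨$⟩ˡ i ≡ τ' ⟨$⟩ˡ i
        step n ih i refl = pointer-injective Δ (rows p) (row-count p)
            (row-at τ υ p i (trans (cong (λ z → inc z i) (inverseʳ υ)) (inc-conn i)))
            (row-at τ' υ' p i (trans (cong (λ z → inc z i) agree) (inc-conn i)))
            (trans (child i) (cong (λ z → pointer Δ (row τ' υ' z) (τ' ⟨$⟩ˡ i)) (sym (to-labels _ agree))))
          where
          p = υ ⟨$⟩ˡ conn i
          agree : υ' ⟨$⟩ʳ p ≡ conn i
          agree = links-agree (conn i) (λ ¬r → ih (par< i ¬r) _ refl)

    same-vertices : ∀ a → τ ⟨$⟩ʳ a ≡ τ' ⟨$⟩ʳ a
    same-vertices a = trans (sym (inverseʳ τ')) (cong (τ' ⟨$⟩ʳ_)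
      (trans (sym (vertices _ (τ ⟨$⟩ʳ a) refl)) (inverseˡ τ)))

    same-links : ∀ p → υ ⟨$⟩ʳ p ≡ υ' ⟨$⟩ʳ p
    same-links p = trans (sym (links-agree (υ ⟨$⟩ʳ p) (λ _ → vertices _ _ refl)))
      (cong (υ' ⟨$⟩ʳ_) (inverseˡ υ))

lookup-injective : ∀ {A : Set} {xs : List A} → Unique xs → ∀ i j → lookup xs i ≡ lookup xs j → i ≡ j
lookup-injective (_ ∷ _)  zero    zero    _ = refl
lookup-injective (px ∷ _) zero    (suc j) e = contradiction e (All.lookup px (∈-lookup j))
lookup-injective (px ∷ _) (suc i) zero    e = contradiction (sym e) (All.lookup px (∈-lookup i))
lookup-injective (_ ∷ u)  (suc i) (suc j) e = cong suc (lookup-injective u i j e)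

-- Minimal cores of hypergraphs

module Hypergraph {n e t : ℕ} (ends : Fin e → Fin (suc t) → Fin n) (D : ℕ) where

  has : Fin e → Fin n → Bool
  has x v = does (any? (λ i → ends x i ≟ v))

  has-end : ∀ x i → has x (ends x i) ≡ true
  has-end x i = dec-true (any? (λ k → ends x k ≟ ends x i)) (i , refl)

  has-witness : ∀ x v → has x v ≡ true → ∃ λ i → ends x i ≡ v
  has-witness x v = does-true (any? (λ k → ends x k ≟ v))

  deg : (Fin e → Bool) → Fin n → ℕ
  deg F v = count (λ x → F x ∧ has x v)

  avoid : (Fin e → Bool) → Fin n → Fin e → Bool
  avoid F v x = F x ∧ not (has x v)

  Closed : (Fin n → Bool) → (Fin e → Bool) → Set
  Closed U F = ∀ x → F x ≡ true → ∀ i → U (ends x i) ≡ true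

  Elim : List (Fin n) → (Fin e → Bool) → Set
  Elim []       F = ∀ x → F x ≡ false
  Elim (v ∷ vs) F = deg F v < D × Elim vs (avoid F v)

  record Peeled (U : Fin n → Bool) (F : Fin e → Bool) : Set where
    field
      order    : List (Fin n)
      unique   : Unique order
      sound    : ∀ {v} → v ∈ order → U v ≡ true
      complete : ∀ {v} → U v ≡ true → v ∈ order
      elim     : Elim order F

  record Core (U : Fin n → Bool) (F : Fin e → Bool) : Set where
    field
      vertex : ∃ λ v → U v ≡ true
      closed : Closed U F
      dense  : ∀ v → U v ≡ true → D ≤ deg F v

  -- Vertices lying in fewer than `D` remaining edges are deleted until none is left or all others
  -- have degree at least `D`; `m` bounds the number of remaining vertices.
  peel : ∀ m U F → count U ≤ m → Closed U F →
    Peeled U F ⊎ (∃ λ U' → ∃ λ F' → Core U' F' × (∀ x → F' x ≡ true → F x ≡ true))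
  peel m U F |U|≤m cl with any? (λ v → (U v Bool.≟ true) ×-dec (deg F v <? D))
  peel m U F |U|≤m cl | no ¬low with any? (λ v → U v Bool.≟ true)
  ... | yes v = inj₂ (U , F , record { vertex = v ; closed = cl ; dense = λ v Uv → ≮⇒≥ (λ lt → ¬low (v , Uv , lt)) } , λ _ p → p)
  ... | no ¬v = inj₁ (record { order = [] ; unique = [] ; sound = λ () ; complete = λ p → contradiction (_ , p) ¬v
                             -- Edges are nonempty, so without vertices there are no edges: the end
                             -- `zero` would be one.
                             ; elim = λ x → Bool.¬-not (λ Fx → ¬v (_ , cl x Fx zero)) })
  peel zero    U F |U|≤m cl | yes (v , Uv , low) = contradiction (≤-trans (count-pos U v Uv) |U|≤m) λ ()
  peel (suc m) U F |U|≤m cl | yes (v , Uv , low)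
    with peel m (U ⊖ v) (avoid F v) (s≤s⁻¹ (subst (_≤ suc m) (count-⊖ U v Uv) |U|≤m))
           (λ x p i → ⊖-true {f = U} {v} {ends x i} (cl x (∧-trueˡ p) i)
             (λ { refl → true≢false (has-end x i) (not-true (∧-trueʳ {F x} p)) }))
  ... | inj₂ (U' , F' , core , sub) = inj₂ (U' , F' , core , λ x p → ∧-trueˡ (sub x p))
  ... | inj₁ P = inj₁ (record
    { order    = v ∷ order
    ; unique   = All.¬Any⇒All¬ order (λ v∈ → ⊖-≢ {f = U} {v} {v} (sound v∈) refl) ∷ unique
    ; sound    = λ { (here refl) → Uv ; (there w∈) → ∧-trueˡ (sound w∈) }
    ; complete = λ {w} Uw → mem (v ≟ w) Uw
    ; elim     = low , elim })
    where
    open Peeled P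
    mem : ∀ {w} → Dec (v ≡ w) → U w ≡ true → w ∈ v ∷ order
    mem (yes refl) _  = here refl
    mem (no v≢w)   Uw = there (complete (⊖-true {f = U} Uw v≢w))

  elim-count : ∀ vs F → Elim vs F → count F ≤ length vs * D
  elim-count []       F h        = ≤-trans (count-mono F (λ _ → false) (λ x p → contradiction (h x) (true≢false p)))
                                     (≤-reflexive (trans (sum-const e 0) (*-zeroʳ e)))
  elim-count (v ∷ vs) F (lt , h) = ≤-trans (≤-reflexive (count-split F (λ x → has x v)))
                                     (+-mono-≤ (<⇒≤ lt) (elim-count vs (avoid F v) h))

  -- In a complete peeling every edge disappears with one of at most n vertices, fewer than `D` at a
  -- time, so there could be no more than n D edges.
  core-exists : n * D < e → ∃ λ U → ∃ λ F → Core U F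
  core-exists many with peel n (λ _ → true) (λ _ → true) (≤-reflexive (count-all n)) (λ _ _ _ → refl)
  ... | inj₂ (U , F , core , _) = U , F , core
  ... | inj₁ P = contradiction many (≤⇒≯ (begin
    e                      ≡⟨ sym (count-all e) ⟩
    count {e} (λ _ → true) ≤⟨ elim-count order (λ _ → true) elim ⟩
    length order * D       ≤⟨ *-monoˡ-≤ D (injective⇒≤ (λ {i} {j} → lookup-injective unique i j)) ⟩
    n * D                  ∎))
    where
    open Peeled P
    open ≤-Reasoning

  -- Deleting the single edge `root` already makes the core peel completely.
  record Minimal : Set where
    field
      {U}    : Fin n → Bool
      {F}    : Fin e → Bool
      core   : Core U F
      root   : Fin e
      F-root : F root ≡ true
      peeled : Peeled U (F ⊖ root)

  -- Descent on the number of edges: if the core without one of its edges does not peel, it contains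
  -- a core with fewer edges.
  minimal-core : 1 ≤ D → ∀ m U F → count F ≤ m → Core U F → Minimal
  minimal-core 1≤D m U F |F|≤m core = go m |F|≤m
    where
    open Core core
    edge : ∃ λ x → F x ∧ has x (proj₁ vertex) ≡ true
    edge = count-witness _ (≤-trans 1≤D (dense _ (proj₂ vertex)))
    root = proj₁ edge
    F-root = ∧-trueˡ {F root} (proj₂ edge)
    go : ∀ m → count F ≤ m → Minimal
    go zero    |F|≤m = contradiction (≤-trans (count-pos F root F-root) |F|≤m) λ ()
    go (suc m) |F|≤m with peel n U (F ⊖ root) (count≤n U) (λ x p → closed x (∧-trueˡ p))
    ... | inj₁ P = record { core = core ; root = root ; F-root = F-root ; peeled = P }
    ... | inj₂ (U' , F' , core' , sub) = minimal-core 1≤D m U' F'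
            (≤-trans (count-mono F' (F ⊖ root) sub) (s≤s⁻¹ (subst (_≤ suc m) (count-⊖ F root F-root) |F|≤m))) core'

  first : List (Fin n) → Fin e → ℕ
  first []       x = 0
  first (v ∷ vs) x = if has x v then 0 else suc (first vs x)

  first-lookup : ∀ vs x (lt : first vs x < length vs) → has x (lookup vs (fromℕ< lt)) ≡ true
  first-lookup (v ∷ vs) x lt with has x v in eq
  ... | true  = eq
  ... | false = first-lookup vs x (s≤s⁻¹ lt)

  first-≤ : ∀ vs x i → has x (lookup vs i) ≡ true → first vs x ≤ toℕ i
  first-≤ (v ∷ vs) x zero    h rewrite h = z≤n
  first-≤ (v ∷ vs) x (suc i) h with has x v
  ... | true  = z≤n
  ... | false = s≤s (first-≤ vs x i h)

  siblings : List (Fin n) → (Fin e → Bool) → ℕ → Fin e → Bool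
  siblings vs F i x = F x ∧ does (first vs x ℕ.≟ i)

  -- The edges with first vertex number i are those that vanish with it, and it is removed when
  -- fewer than `D` edges are left at it.
  siblings-count : ∀ vs F → Elim vs F → ∀ i → i < length vs → count (siblings vs F i) < D
  siblings-count (v ∷ vs) F (low , el) zero lt = ≤-<-trans (count-mono (siblings (v ∷ vs) F 0) _ sub) low
    where
    sub : ∀ x → siblings (v ∷ vs) F 0 x ≡ true → F x ∧ has x v ≡ true
    sub x p with has x v
    ... | true  = ∧-true (∧-trueˡ p) refl
    ... | false = contradiction (∧-trueʳ {F x} p) λ ()
  siblings-count (v ∷ vs) F (low , el) (suc i) (s≤s lt) =
    ≤-<-trans (count-mono (siblings (v ∷ vs) F (suc i)) _ sub) (siblings-count vs (avoid F v) el i lt)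
    where
    sub : ∀ x → siblings (v ∷ vs) F (suc i) x ≡ true → siblings vs (avoid F v) i x ≡ true
    sub x p with has x v
    ... | true  = contradiction (∧-trueʳ {F x} p) λ ()
    ... | false = ∧-true (∧-true (∧-trueˡ p) refl) (∧-trueʳ {F x} p)

-- The embedded tree (branch vertices α, tree links γ) and the μ N blocks δ of s further links.
record Selection {n e t : ℕ} (ends : Fin e → Fin (suc t) → Fin n) (I : Fin e → Fin n → Bool) (Δ D μ s : ℕ) : Set where
  field
    {N N'}  : ℕ
    N≥1     : 1 ≤ N
    N'≤N    : N' ≤ N
    α       : Fin N → Fin n
    γ       : Fin N' → Fin e
    δ       : Fin (μ * N) → Fin s → Fin e
    α-inj   : ∀ {a b} → α a ≡ α b → a ≡ b
    γ-inj   : ∀ {p q} → γ p ≡ γ q → p ≡ q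
    δ-inj   : ∀ {p q x y} → δ p x ≡ δ q y → p ≡ q × x ≡ y
    γ≢δ     : ∀ {p q x} → γ p ≢ δ q x
    γ-ends  : ∀ p i → ∃ λ a → α a ≡ ends (γ p) i
    δ-ends  : ∀ q x i → ∃ λ a → α a ≡ ends (δ q x) i
    tree    : Tree N N' Δ (suc D)
    tree-inc : ∀ p a → Tree.inc tree p a ≡ I (γ p) (α a)

module FromMinimal {n e t : ℕ} (ends : Fin e → Fin (suc t) → Fin n) (I : Fin e → Fin n → Bool)
  (I-ends : ∀ x i → I x (ends x i) ≡ true) (Δ : ℕ) (I-count : ∀ x → count (I x) ≤ Δ)
  (D μ s : ℕ) (D-large : suc t * suc (s * μ) ≤ D) (minimal : Hypergraph.Minimal ends D) where

  open Hypergraph ends D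
  open Minimal minimal
  open Core core
  open Peeled peeled

  private
    N : ℕ
    N = length order

    α : Fin N → Fin n
    α = lookup order

    α-inj : ∀ {a b} → α a ≡ α b → a ≡ b
    α-inj {a} {b} = lookup-injective unique a b

    α-sound : ∀ a → U (α a) ≡ true
    α-sound a = sound (∈-lookup a)

    α-complete : ∀ {v} → U v ≡ true → ∃ λ a → α a ≡ v
    α-complete Uv = index (complete Uv) , sym (lookup-index (complete Uv))

    F-ends : ∀ {x} → F x ≡ true → ∀ i → ∃ λ a → α a ≡ ends x i
    F-ends {x} Fx i = α-complete (closed x Fx i)

    pos : Fin e → ℕ
    pos = first order

    pos<N : ∀ {x} → F x ≡ true → pos x < N
    pos<N {x} Fx with a , eq ← F-ends Fx zero =
      ≤-<-trans (first-≤ order x a (trans (cong (has x) eq) (has-end x zero))) (toℕ<n a)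

    Linked : Fin N → Fin e → Set
    Linked i x = F x ≡ true × has x (α i) ≡ true × (x ≡ root ⊎ pos x < toℕ i)

    link? : ∀ i → Dec (∃ (Linked i))
    link? i = any? (λ x → (F x Bool.≟ true) ×-dec (has x (α i) Bool.≟ true) ×-dec ((x ≟ root) ⊎-dec (pos x <? toℕ i)))

    -- In the core `α i` lies on at least `D` edges, but fewer than `D` edges other than the root
    -- have it as first vertex. Some edge through it is therefore the root or has an earlier first
    -- vertex. The root serves the vertices, such as the very first, that have no earlier one to
    -- attach to.
    link : ∀ i → ∃ (Linked i)
    link i with link? i
    ... | yes l = l
    ... | no ¬l = contradiction (dense _ (α-sound i))
            (<⇒≱ (≤-<-trans (count-mono (λ x → F x ∧ has x (α i)) (siblings order (F ⊖ root) (toℕ i)) sub)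
              (siblings-count order (F ⊖ root) elim (toℕ i) (toℕ<n i))))
      where
      sub : ∀ x → F x ∧ has x (α i) ≡ true → siblings order (F ⊖ root) (toℕ i) x ≡ true
      sub x p = ∧-true (⊖-true {f = F} {root} {x} Fx (λ r → ¬l (x , Fx , hx , inj₁ (sym r))))
          (dec-true (pos x ℕ.≟ toℕ i) (≤-antisym (first-≤ order x i hx) (≮⇒≥ (λ lt → ¬l (x , Fx , hx , inj₂ lt)))))
        where
        Fx = ∧-trueˡ {F x} p
        hx = ∧-trueʳ {F x} p

    linkOf : Fin N → Fin e
    linkOf i = proj₁ (link i)

    isLink : Fin e → Bool
    isLink x = does (any? (λ i → linkOf i ≟ x))

    isLink-witness : ∀ {x} → isLink x ≡ true → ∃ λ i → linkOf i ≡ x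
    isLink-witness {x} = does-true (any? (λ i → linkOf i ≟ x))

    linkOf-isLink : ∀ i → isLink (linkOf i) ≡ true
    linkOf-isLink i = dec-true (any? (λ j → linkOf j ≟ linkOf i)) (i , refl)

    isLink-F : ∀ {x} → isLink x ≡ true → F x ≡ true
    isLink-F p with i , refl ← isLink-witness p = proj₁ (proj₂ (link i))

    N' : ℕ
    N' = count isLink

    γ : Fin N' → Fin e
    γ = enum isLink

    γ-F : ∀ p → F (γ p) ≡ true
    γ-F p = isLink-F (enum-true isLink p)

    N≥1 : 1 ≤ N
    N≥1 with a , _ ← α-complete (proj₂ vertex) = ≤-trans (s≤s z≤n) (toℕ<n a)

    N'≤N : N' ≤ N
    N'≤N = ≤-trans (count-injective isLink (λ _ → true) g inj (λ _ _ → refl)) (≤-reflexive (count-all N))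
      where
      g : ∀ x → isLink x ≡ true → Fin N
      g x p = proj₁ (isLink-witness p)
      inj : ∀ x y p q → g x p ≡ g y q → x ≡ y
      inj x y p q eq = trans (sym (proj₂ (isLink-witness p))) (trans (cong linkOf eq) (proj₂ (isLink-witness q)))

    other : Fin e → Bool
    other x = F x ∧ not (isLink x)

    F-count : N * D ≤ suc t * count F
    F-count = begin
      N * D                                                        ≡⟨ sym (sum-const N D) ⟩
      sum {N} (λ _ → D)                                            ≤⟨ sum-mono {N} (λ _ → D) _ (λ i → dense _ (α-sound i)) ⟩
      sum {N} (λ i → sum {e} (λ x → b2n (F x ∧ has x (α i))))      ≡⟨ ∑-comm (λ i x → b2n (F x ∧ has x (α i))) ⟩
      sum {e} (λ x → sum {N} (λ i → b2n (F x ∧ has x (α i))))      ≤⟨ sum-mono {e} _ (λ x → suc t * b2n (F x)) ends-of ⟩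
      sum {e} (λ x → suc t * b2n (F x))                            ≡⟨ sym (*-distribˡ-sum (suc t) (b2n ∘ F)) ⟩
      suc t * count F                                              ∎
      where
      open ≤-Reasoning
      has-count : ∀ x → count (λ i → has x (α i)) ≤ suc t
      has-count x = ≤-trans (count-injective _ (λ _ → true) g inj (λ _ _ → refl)) (≤-reflexive (count-all (suc t)))
        where
        g : ∀ i → has x (α i) ≡ true → Fin (suc t)
        g i p = proj₁ (has-witness x (α i) p)
        inj : ∀ i j p q → g i p ≡ g j q → i ≡ j
        inj i j p q eq = α-inj (trans (sym (proj₂ (has-witness x (α i) p)))
          (trans (cong (ends x) eq) (proj₂ (has-witness x (α j) q))))
      ends-of : ∀ x → sum {N} (λ i → b2n (F x ∧ has x (α i))) ≤ suc t * b2n (F x)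
      ends-of x with F x
      ... | true  = ≤-trans (has-count x) (≤-reflexive (sym (*-identityʳ (suc t))))
      ... | false = ≤-trans (≤-reflexive (trans (sum-const N 0) (*-zeroʳ N))) z≤n

    -- This determines the size of `D`: with N D at most t + 1 times the number of edges, the core
    -- has at least N (s μ + 1) edges, of which at most N are tree links.
    other-count : μ * N * s ≤ count other
    other-count = +-cancelˡ-≤ N _ _ (*-cancelˡ-≤ (suc t) (begin
      suc t * (N + μ * N * s)         ≡⟨ solve 4 (λ T n m z → T :* (n :+ m :* n :* z) := n :* (T :* (con 1 :+ z :* m))) refl (suc t) N μ s ⟩
      N * (suc t * suc (s * μ))       ≤⟨ *-monoʳ-≤ N D-large ⟩
      N * D                           ≤⟨ F-count ⟩
      suc t * count F                 ≤⟨ *-monoʳ-≤ (suc t) F≤ ⟩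
      suc t * (N + count other)       ∎))
      where
      open ≤-Reasoning
      open +-*-Solver
      F≤ : count F ≤ N + count other
      F≤ = ≤-trans (≤-reflexive (count-split F isLink)) (+-monoˡ-≤ (count other)
        (≤-trans (count-mono (λ x → F x ∧ isLink x) isLink (λ x p → ∧-trueʳ {F x} p)) N'≤N))

    δ : Fin (μ * N) → Fin s → Fin e
    δ q x = enum other (inject≤ (combine q x) other-count)

    other-δ : ∀ q x → other (δ q x) ≡ true
    other-δ q x = enum-true other (inject≤ (combine q x) other-count)

    δ-inj : ∀ {p q x y} → δ p x ≡ δ q y → p ≡ q × x ≡ y
    δ-inj {p} {q} {x} {y} eq = combine-injective p x q y
      (inject≤-injective other-count other-count _ _ (enum-injective other _ _ eq))

    par : Fin N' → Fin N
    par p = fromℕ< (pos<N (γ-F p))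

    nonRoot : ℕ → Fin e → Bool
    nonRoot = siblings order (F ⊖ root)

    -- The peeling was done without the root, so only the other edges have few siblings and can be
    -- tagged by their rank among them; `zero` is kept for the root.
    tagOf : ∀ {x} → Dec (x ≡ root) → Fin (suc (suc D))
    tagOf (yes _)     = zero
    tagOf {x} (no _)  = suc (pointer D (nonRoot (pos x)) x)

    tag : Fin N' → Fin (suc (suc D))
    tag p = tagOf (γ p ≟ root)

    tagOf-root : ∀ {x} (d : Dec (x ≡ root)) → tagOf d ≡ zero → x ≡ root
    tagOf-root (yes r) _ = r

    tagOf-unique : ∀ {x y} (d : Dec (x ≡ root)) (d' : Dec (y ≡ root)) → F x ≡ true → F y ≡ true →
      pos x ≡ pos y → tagOf d ≡ tagOf d' → x ≡ y
    tagOf-unique (yes r) (yes r') _ _ _ _ = trans r (sym r')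
    tagOf-unique {x} {y} (no ¬r) (no ¬r') Fx Fy eq teq = pointer-injective D
      (λ z → cong (λ i → nonRoot i z) eq)
      (<⇒≤ (siblings-count order (F ⊖ root) elim (pos x) (pos<N Fx)))
      (self ¬r Fx) (self ¬r' Fy) (suc-injective teq)
      where
      self : ∀ {z} → ¬ z ≡ root → F z ≡ true → nonRoot (pos z) z ≡ true
      self {z} ¬r Fz = ∧-true (⊖-true {f = F} {root} {z} Fz (¬r ∘ sym)) (dec-true (pos z ℕ.≟ pos z) refl)

    conn : Fin N → Fin N'
    conn i = proj₁ (enum-surjective isLink (linkOf i) (linkOf-isLink i))

    γ-conn : ∀ i → γ (conn i) ≡ linkOf i
    γ-conn i = proj₂ (enum-surjective isLink (linkOf i) (linkOf-isLink i))

    has-I : ∀ x v → has x v ≡ true → I x v ≡ true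
    has-I x v p with k , refl ← has-witness x v p = I-ends x k

    tree : Tree N N' Δ (suc D)
    tree = record
      { inc         = λ p a → I (γ p) (α a)
      ; par         = par
      ; tag         = tag
      ; conn        = conn
      ; inc-count   = λ p → ≤-trans (count-injective _ (I (γ p)) (λ a _ → α a) (λ _ _ _ _ → α-inj) (λ _ h → h)) (I-count (γ p))
      ; inc-par     = λ p → has-I _ _ (first-lookup order (γ p) (pos<N (γ-F p)))
      ; inc-conn    = λ i → has-I _ _ (subst (λ x → has x (α i) ≡ true) (sym (γ-conn i)) (proj₁ (proj₂ (proj₂ (link i)))))
      ; root-unique = λ p q tp tq → enum-injective isLink p q
                        (trans (tagOf-root (γ p ≟ root) tp) (sym (tagOf-root (γ q ≟ root) tq)))
      ; tag-unique  = λ p q pp tt → enum-injective isLink p q (tagOf-unique (γ p ≟ root) (γ q ≟ root) (γ-F p) (γ-F q)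
                        (trans (sym (toℕ-fromℕ< (pos<N (γ-F p)))) (trans (cong toℕ pp) (toℕ-fromℕ< (pos<N (γ-F q))))) tt)
      ; par<        = earlier
      }
      where
      earlier : ∀ i → tag (conn i) ≢ zero → toℕ (par (conn i)) < toℕ i
      earlier i ¬r = subst (_< toℕ i) (sym (toℕ-fromℕ< (pos<N (γ-F (conn i)))))
          (go (γ (conn i) ≟ root) ¬r (subst (λ x → x ≡ root ⊎ pos x < toℕ i) (sym (γ-conn i)) (proj₂ (proj₂ (proj₂ (link i))))))
        where
        go : ∀ {x} (d : Dec (x ≡ root)) → tagOf d ≢ zero → x ≡ root ⊎ pos x < toℕ i → pos x < toℕ i
        go (yes _) ¬z _         = contradiction refl ¬z
        go (no ¬q) _  (inj₁ r)  = contradiction r ¬q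
        go (no _)  _  (inj₂ lt) = lt

  selection : Selection ends I Δ D μ s
  selection = record
    { N≥1      = N≥1
    ; N'≤N     = N'≤N
    ; α        = α
    ; γ        = γ
    ; δ        = δ
    ; α-inj    = α-inj
    ; γ-inj    = λ {p} {q} → enum-injective isLink p q
    ; δ-inj    = δ-inj
    ; γ≢δ      = λ {p} {q} {x} eq → true≢false (enum-true isLink p)
                   (trans (cong isLink eq) (not-true (∧-trueʳ {F (δ q x)} (other-δ q x))))
    ; γ-ends   = λ p → F-ends (γ-F p)
    ; δ-ends   = λ q x → F-ends (∧-trueˡ (other-δ q x))
    ; tree     = tree
    ; tree-inc = λ _ _ → refl
    }

selection-exists : ∀ {n e t} (ends : Fin e → Fin (suc t) → Fin n) (I : Fin e → Fin n → Bool) →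
  (∀ x i → I x (ends x i) ≡ true) → ∀ Δ → (∀ x → count (I x) ≤ Δ) →
  ∀ D μ s → suc t * suc (s * μ) ≤ D → n * D < e → Selection ends I Δ D μ s
selection-exists {e = e} ends I I-ends Δ I-count D μ s D-large many with Hypergraph.core-exists ends D many
... | U , F , core = FromMinimal.selection ends I I-ends Δ I-count D μ s D-large
  (Hypergraph.minimal-core ends D (≤-trans (s≤s z≤n) D-large) e U F (count≤n F) core)

-- Estimates

^-distribʳ-* : ∀ n a b → (a * b) ^ n ≡ a ^ n * b ^ n
^-distribʳ-* zero    a b = refl
^-distribʳ-* (suc n) a b = trans (cong (a * b *_) (^-distribʳ-* n a b))
  (solve 4 (λ a b A B → a :* b :* (A :* B) := a :* A :* (b :* B)) refl a b (a ^ n) (b ^ n))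
  where open +-*-Solver

-- A binomial coefficient is at most a power of two; the induction is Pascal's rule.
!-split : ∀ a b → (a + b) ! ≤ 2 ^ (a + b) * (a ! * b !)
!-split zero    b       = ≤-trans (≤-reflexive (sym (*-identityˡ (b !)))) (*-mono-≤ (m^n>0 2 b) (≤-reflexive (sym (*-identityˡ (b !)))))
!-split (suc a) zero    rewrite +-identityʳ a = ≤-trans (≤-reflexive (sym (*-identityˡ (suc a !))))
  (*-mono-≤ (m^n>0 2 (suc a)) (≤-reflexive (sym (*-identityʳ (suc a !)))))
!-split (suc a) (suc b) = begin
  suc (a + suc b) * (a + suc b) !                            ≡⟨ cong (_* (a + suc b) !) (+-suc (suc a) b) ⟩
  (suc (suc a + b)) * (a + suc b) !                          ≡⟨ solve 3 (λ a b F → (con 1 :+ (con 1 :+ a :+ b)) :* F := (con 1 :+ a) :* F :+ (con 1 :+ b) :* F) refl a b ((a + suc b) !) ⟩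
  suc a * (a + suc b) ! + suc b * (a + suc b) !              ≡⟨ cong (λ z → suc a * (a + suc b) ! + suc b * z !) (+-suc a b) ⟩
  suc a * (a + suc b) ! + suc b * (suc a + b) !              ≤⟨ +-mono-≤ (*-monoʳ-≤ (suc a) (!-split a (suc b))) (*-monoʳ-≤ (suc b) (!-split (suc a) b)) ⟩
  suc a * (2 ^ (a + suc b) * (a ! * suc b !)) + suc b * (2 ^ (suc a + b) * (suc a ! * b !))
    ≡⟨ cong (λ z → suc a * (2 ^ (a + suc b) * (a ! * suc b !)) + suc b * (2 ^ z * (suc a ! * b !))) (sym (+-suc a b)) ⟩
  suc a * (2 ^ (a + suc b) * (a ! * suc b !)) + suc b * (2 ^ (a + suc b) * (suc a ! * b !))
    ≡⟨ solve 5 (λ a b P F G → (con 1 :+ a) :* (P :* (F :* ((con 1 :+ b) :* G))) :+ (con 1 :+ b) :* (P :* (((con 1 :+ a) :* F) :* G))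
                  := (con 2 :* P) :* (((con 1 :+ a) :* F) :* ((con 1 :+ b) :* G))) refl a b (2 ^ (a + suc b)) (a !) (b !) ⟩
  2 ^ (suc a + suc b) * (suc a ! * suc b !)                  ∎
  where
  open ≤-Reasoning
  open +-*-Solver

!-multiple : ∀ r n → (r * n) ! ≤ 2 ^ (r * (r * n)) * (n !) ^ r
!-multiple zero    n = ≤-refl
!-multiple (suc r) n = begin
  (n + r * n) !                                               ≤⟨ !-split n (r * n) ⟩
  2 ^ (n + r * n) * (n ! * (r * n) !)                         ≤⟨ *-monoʳ-≤ (2 ^ (n + r * n)) (*-monoʳ-≤ (n !) (!-multiple r n)) ⟩
  2 ^ (n + r * n) * (n ! * (2 ^ (r * (r * n)) * (n !) ^ r))   ≡⟨ solve 4 (λ A F B G → A :* (F :* (B :* G)) := (A :* B) :* (F :* G)) refl (2 ^ (n + r * n)) (n !) (2 ^ (r * (r * n))) ((n !) ^ r) ⟩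
  2 ^ (n + r * n) * 2 ^ (r * (r * n)) * (n !) ^ suc r         ≡⟨ cong (_* (n !) ^ suc r) (sym (^-distribˡ-+-* 2 (n + r * n) (r * (r * n)))) ⟩
  2 ^ (n + r * n + r * (r * n)) * (n !) ^ suc r               ≤⟨ *-monoˡ-≤ ((n !) ^ suc r) (^-monoʳ-≤ 2 (+-monoʳ-≤ (n + r * n) (*-monoʳ-≤ r (m≤n+m (r * n) n)))) ⟩
  2 ^ (suc r * (suc r * n)) * (n !) ^ suc r                   ∎
  where
  open ≤-Reasoning
  open +-*-Solver

-- The quotient of the factorials is a multinomial coefficient: k labels are shared out among 1 + 2ρ
-- kinds of vertices. Two binary splits give the 2 in the exponent, the splits into ρ equal parts
-- give the ρ.
!-parts : ∀ ρ N N' M → let k = N + (ρ * N' + ρ * M) in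
  k ! ≤ (2 ^ (2 + ρ)) ^ k * (N ! * ((N' !) ^ ρ * (M !) ^ ρ))
!-parts ρ N N' M = begin
  k !                                                   ≤⟨ !-split N l ⟩
  2 ^ k * (N ! * l !)                                   ≤⟨ *-monoʳ-≤ (2 ^ k) (*-monoʳ-≤ (N !) l!≤) ⟩
  2 ^ k * (N ! * (2 ^ k * ((2 ^ (ρ * a) * A) * (2 ^ (ρ * b) * B))))
    ≡⟨ solve 6 (λ K F P Q A B → K :* (F :* (K :* ((P :* A) :* (Q :* B)))) := (K :* (K :* (P :* Q))) :* (F :* (A :* B))) refl (2 ^ k) (N !) (2 ^ (ρ * a)) (2 ^ (ρ * b)) A B ⟩
  2 ^ k * (2 ^ k * (2 ^ (ρ * a) * 2 ^ (ρ * b))) * (N ! * (A * B))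
    ≡⟨ cong (_* (N ! * (A * B))) powers ⟩
  2 ^ (k + (k + (ρ * a + ρ * b))) * (N ! * (A * B))     ≤⟨ *-monoˡ-≤ (N ! * (A * B)) (^-monoʳ-≤ 2 exponent) ⟩
  2 ^ ((2 + ρ) * k) * (N ! * (A * B))                   ≡⟨ cong (_* (N ! * (A * B))) (sym (^-*-assoc 2 (2 + ρ) k)) ⟩
  (2 ^ (2 + ρ)) ^ k * (N ! * (A * B))                   ∎
  where
  open ≤-Reasoning
  open +-*-Solver
  a = ρ * N'
  b = ρ * M
  l = a + b
  k = N + l
  A = (N' !) ^ ρ
  B = (M !) ^ ρ
  l!≤ : l ! ≤ 2 ^ k * ((2 ^ (ρ * a) * A) * (2 ^ (ρ * b) * B))
  l!≤ = ≤-trans (!-split a b) (*-mono-≤ (^-monoʳ-≤ 2 (m≤n+m l N)) (*-mono-≤ (!-multiple ρ N') (!-multiple ρ M)))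
  powers : 2 ^ k * (2 ^ k * (2 ^ (ρ * a) * 2 ^ (ρ * b))) ≡ 2 ^ (k + (k + (ρ * a + ρ * b)))
  powers = sym (trans (^-distribˡ-+-* 2 k _) (cong (2 ^ k *_) (trans (^-distribˡ-+-* 2 k _) (cong (2 ^ k *_) (^-distribˡ-+-* 2 (ρ * a) (ρ * b))))))
  exponent : k + (k + (ρ * a + ρ * b)) ≤ (2 + ρ) * k
  exponent = +-monoʳ-≤ k (+-monoʳ-≤ k (≤-trans (≤-reflexive (sym (*-distribˡ-+ ρ a b))) (*-monoʳ-≤ ρ (m≤n+m l N))))

-- Per label everything but the tree costs a factor C, and there are at most (1 + 2ρ) μ N labels, so blocks of
-- size 2 C^(1 + 2ρ) gain a factor 2^μ per tree vertex.
blocks-win : ∀ ρ N N' μ W Δ' C → 1 ≤ N → N' ≤ N → 1 ≤ C → 1 ≤ W → 1 ≤ μ → W * Δ' < 2 ^ μ →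
  let k = N + (ρ * N' + ρ * (μ * N)) in
  (2 * C ^ (1 + 2 * ρ)) ^ (μ * N) ≤ (W ^ N' * Δ' ^ N) * C ^ k → ⊥
blocks-win ρ N N' μ W Δ' C 1≤N N'≤N 1≤C 1≤W 1≤μ W<2^μ h = <⇒≱ strict weak
  where
  instance
    C≢0 : NonZero C
    C≢0 = >-nonZero 1≤C
    W≢0 : NonZero W
    W≢0 = >-nonZero 1≤W
    N≢0 : NonZero N
    N≢0 = >-nonZero 1≤N
  E = 1 + 2 * ρ
  k = N + (ρ * N' + ρ * (μ * N))
  -- `x` and `y` are the two sides of `h` per branch vertex, once k has been replaced by its bound E
  -- μ N.
  x = W * Δ' * C ^ (E * μ)
  y = (2 * C ^ E) ^ μ
  x<y : x < y
  x<y = <-≤-trans (*-monoˡ-< (C ^ (E * μ)) {{m^n≢0 C (E * μ)}} W<2^μ)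
    (≤-reflexive (sym (trans (^-distribʳ-* μ 2 (C ^ E)) (cong (2 ^ μ *_) (^-*-assoc C E μ)))))
  strict : x ^ N < y ^ N
  strict = ^-monoˡ-< N x<y
  k≤ : k ≤ E * μ * N
  k≤ = begin
    N + (ρ * N' + ρ * (μ * N))        ≤⟨ +-monoʳ-≤ N (+-monoˡ-≤ _ (*-monoʳ-≤ ρ N'≤N)) ⟩
    N + (ρ * N + ρ * (μ * N))         ≡⟨ solve 3 (λ n r m → n :+ (r :* n :+ r :* (m :* n)) := (con 1 :+ r) :* con 1 :* n :+ r :* m :* n) refl N ρ μ ⟩
    suc ρ * 1 * N + ρ * μ * N         ≤⟨ +-monoˡ-≤ _ (*-monoˡ-≤ N (*-monoʳ-≤ (suc ρ) 1≤μ)) ⟩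
    suc ρ * μ * N + ρ * μ * N         ≡⟨ solve 3 (λ n r m → (con 1 :+ r) :* m :* n :+ r :* m :* n := (con 1 :+ con 2 :* r) :* m :* n) refl N ρ μ ⟩
    E * μ * N                         ∎
    where
    open ≤-Reasoning
    open +-*-Solver
  weak : y ^ N ≤ x ^ N
  weak = begin
    y ^ N                                  ≡⟨ ^-*-assoc (2 * C ^ E) μ N ⟩
    (2 * C ^ E) ^ (μ * N)                  ≤⟨ h ⟩
    (W ^ N' * Δ' ^ N) * C ^ k              ≤⟨ *-mono-≤ (*-monoˡ-≤ (Δ' ^ N) (^-monoʳ-≤ W N'≤N)) (^-monoʳ-≤ C k≤) ⟩
    (W ^ N * Δ' ^ N) * C ^ (E * μ * N)     ≡⟨ cong₂ _*_ (sym (^-distribʳ-* N W Δ')) (sym (^-*-assoc C (E * μ) N)) ⟩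
    (W * Δ') ^ N * (C ^ (E * μ)) ^ N       ≡⟨ sym (^-distribʳ-* N (W * Δ') (C ^ (E * μ))) ⟩
    x ^ N                                  ∎
    where open ≤-Reasoning

n<2^n : ∀ n → n < 2 ^ n
n<2^n zero    = s≤s z≤n
n<2^n (suc n) = begin
  2 + n             ≡⟨ sym (+-comm (suc n) 1) ⟩
  suc n + 1         ≤⟨ +-mono-≤ (n<2^n n) (m^n>0 2 n) ⟩
  2 ^ n + 2 ^ n     ≡⟨ cong (2 ^ n +_) (sym (+-identityʳ (2 ^ n))) ⟩
  2 ^ suc n         ∎
  where open ≤-Reasoning

-- With μ = 4 x each of the three factors is at most 4 times 2^x. They leave 64 a to be beaten by
-- the fourth factor 2^x, whence x = 64 a.
cubic<exponential : ∀ a → ∃ λ μ → a * (suc μ * (suc μ * suc μ)) < 2 ^ μ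
cubic<exponential a = 4 * x , (begin-strict
  a * (suc (4 * x) * (suc (4 * x) * suc (4 * x)))     ≤⟨ *-monoʳ-≤ a (*-mono-≤ step (*-mono-≤ step step)) ⟩
  a * (4 * 2 ^ x * (4 * 2 ^ x * (4 * 2 ^ x)))         ≡⟨ solve 2 (λ a P → a :* (con 4 :* P :* (con 4 :* P :* (con 4 :* P))) := (con 64 :* a) :* (P :* (P :* P))) refl a (2 ^ x) ⟩
  x * (2 ^ x * (2 ^ x * 2 ^ x))                       <⟨ *-monoˡ-< _ {{m*n≢0 (2 ^ x) _ {{p}} {{m*n≢0 (2 ^ x) (2 ^ x) {{p}} {{p}}}}}} (n<2^n x) ⟩
  2 ^ x * (2 ^ x * (2 ^ x * 2 ^ x))                   ≡⟨ solve 1 (λ P → P :* (P :* (P :* P)) := P :* (P :* (P :* (P :* con 1)))) refl (2 ^ x) ⟩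
  (2 ^ x) ^ 4                                         ≡⟨ ^-*-assoc 2 x 4 ⟩
  2 ^ (x * 4)                                         ≡⟨ cong (2 ^_) (*-comm x 4) ⟩
  2 ^ (4 * x)                                         ∎)
  where
  open ≤-Reasoning
  open +-*-Solver
  x = 64 * a
  p : NonZero (2 ^ x)
  p = m^n≢0 2 x
  step : suc (4 * x) ≤ 4 * 2 ^ x
  step = ≤-trans (s≤s (m≤n+m (4 * x) 3)) (≤-trans (≤-reflexive (sym (*-suc 4 x))) (*-monoʳ-≤ 4 (n<2^n x)))

-- The contradiction

module Embedded {m n e t ρ : ℕ} (H : Graph (Fin m)) (vert : Fin n ⊎ (Fin (suc ρ) × Fin e) → Fin m)
  (vert-inj : Injective _≡_ _≡_ vert) {ends : Fin e → Fin (suc t) → Fin n} {I : Fin e → Fin n → Bool}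
  {Δ D μ s : ℕ} (sel : Selection ends I Δ D μ s) where

  open Selection sel

  Conf : Set
  Conf = Config N N' (μ * N) s (suc ρ)

  #L : ℕ
  #L = #labels {N} {N'} {μ * N} {s} {suc ρ}

  emb : Point {N} {N'} {μ * N} {s} {suc ρ} → Fin m
  emb (inj₁ a)                    = vert (inj₁ (α a))
  emb (inj₂ (inj₁ (j , p)))       = vert (inj₂ (j , γ p))
  emb (inj₂ (inj₂ (j , (q , x)))) = vert (inj₂ (j , δ q x))

  private
    at-branch : ∀ {a b} → vert (inj₁ a) ≡ vert (inj₁ b) → a ≡ b
    at-branch eq = inj₁-injective (vert-inj eq)

    at-link : ∀ {j j' x y} → vert (inj₂ (j , x)) ≡ vert (inj₂ (j' , y)) → j ≡ j' × x ≡ y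
    at-link eq = cong proj₁ (inj₂-injective (vert-inj eq)) , cong proj₂ (inj₂-injective (vert-inj eq))

  emb-inj : Injective _≡_ _≡_ emb
  emb-inj {inj₁ a} {inj₁ b} eq = cong inj₁ (α-inj (at-branch eq))
  emb-inj {inj₁ _} {inj₂ (inj₁ _)} eq = contradiction (vert-inj eq) λ ()
  emb-inj {inj₁ _} {inj₂ (inj₂ _)} eq = contradiction (vert-inj eq) λ ()
  emb-inj {inj₂ (inj₁ _)} {inj₁ _} eq = contradiction (vert-inj eq) λ ()
  emb-inj {inj₂ (inj₂ _)} {inj₁ _} eq = contradiction (vert-inj eq) λ ()
  emb-inj {inj₂ (inj₁ (j , p))} {inj₂ (inj₁ (j' , p'))} eq =
    cong₂ (λ x y → inj₂ (inj₁ (x , y))) (proj₁ (at-link eq)) (γ-inj (proj₂ (at-link eq)))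
  emb-inj {inj₂ (inj₁ _)} {inj₂ (inj₂ _)} eq = contradiction (proj₂ (at-link eq)) γ≢δ
  emb-inj {inj₂ (inj₂ _)} {inj₂ (inj₁ _)} eq = contradiction (sym (proj₂ (at-link eq))) γ≢δ
  emb-inj {inj₂ (inj₂ (j , (q , x)))} {inj₂ (inj₂ (j' , (q' , x')))} eq
    with refl ← proj₁ (at-link eq) | refl , refl ← δ-inj (proj₂ (at-link eq)) = refl

  Pattern : Conf → Conf → Set
  Pattern = SamePattern H emb

  -- `SameLinks` is the equality of rows that the tree code presupposes. For r = 0 the rows are
  -- adjacencies and visible at once; for r ≥ 1 they are recovered from the codes of the paths.
  SameLinks SameCore : Conf → Conf → Set
  SameLinks C C' = ∀ p a → I (γ (κ C zero ⟨$⟩ʳ p)) (α (π C ⟨$⟩ʳ a)) ≡ I (γ (κ C' zero ⟨$⟩ʳ p)) (α (π C' ⟨$⟩ʳ a))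
  SameCore C C' = (∀ a → π C ⟨$⟩ʳ a ≡ π C' ⟨$⟩ʳ a) × (∀ p → κ C zero ⟨$⟩ʳ p ≡ κ C' zero ⟨$⟩ʳ p)

  -- `light` is what remains to be encoded apart from the tree, at cost Λ per label.
  impossible : (X : GraphPred) (c : ℕ) → 1 ≤ c → Hereditary X → HasSpeed X c → X H →
    ∀ {R} (light : Conf → Fin R) (Λ : ℕ) → 1 ≤ Λ → R ≤ Λ ^ #L →
    (∀ C C' → light C ≡ light C' → Pattern C C' → SameLinks C C') →
    (∀ C C' → light C ≡ light C' → Pattern C C' → SameCore C C' → C ≈ C') →
    1 ≤ μ → (suc Δ * suc (suc D)) * suc Δ < 2 ^ μ →
    s ≡ 2 * (2 ^ (3 + ρ) * (Λ * c)) ^ (1 + 2 * suc ρ) → ⊥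
  impossible X c 1≤c her speed XH {R} light Λ 1≤Λ R≤ links-same all-same 1≤μ W<2^μ s≡ =
    blocks-win (suc ρ) N N' μ W (suc Δ) base N≥1 N'≤N
      (*-mono-≤ (m^n>0 2 (3 + ρ)) (*-mono-≤ 1≤Λ 1≤c)) (s≤s z≤n) 1≤μ W<2^μ
      (subst (λ z → z ^ (μ * N) ≤ tree# * base ^ #L) s≡ few)
    where
    open TreeCode tree using (row; treeCode; same-vertices; same-links)
    W base tree# K : ℕ
    W = suc Δ * suc (suc D)
    base = 2 ^ (3 + ρ) * (Λ * c)
    tree# = W ^ N' * suc Δ ^ N
    K = N ! * ((N' !) ^ suc ρ * ((μ * N) !) ^ suc ρ)

    enc : Conf → Fin (tree# * R)
    enc C = combine (treeCode (π C) (κ C zero)) (light C)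

    decode : ∀ C C' → enc C ≡ enc C' → Pattern C C' → C ≈ C'
    decode C C' eq same = all-same C C' leq same
        ( same-vertices (π C) (π C') (κ C zero) (κ C' zero) rows teq
        , same-links (π C) (π C') (κ C zero) (κ C' zero) rows teq)
      where
      halves : treeCode (π C) (κ C zero) ≡ treeCode (π C') (κ C' zero) × light C ≡ light C'
      halves = combine-injective (treeCode (π C) (κ C zero)) (light C) _ _ eq
      teq = proj₁ halves
      leq = proj₂ halves
      rows : ∀ p v → row (π C) (κ C zero) p v ≡ row (π C') (κ C' zero) p v
      rows p a = trans (tree-inc _ _) (trans (links-same C C' leq same p a) (sym (tree-inc _ _)))

    instance
      K≢0 : NonZero K
      K≢0 = m*n≢0 (N !) _ {{N !≢0}} {{m*n≢0 _ _ {{m^n≢0 (N' !) (suc ρ) {{N' !≢0}}}} {{m^n≢0 ((μ * N) !) (suc ρ) {{(μ * N) !≢0}}}}}}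

    -- `K` counts the labellings. `!-parts` extracts the same number from the factorial in the speed
    -- bound, so it cancels and only exponential terms remain.
    few : s ^ (μ * N) ≤ tree# * base ^ #L
    few = *-cancelˡ-≤ K (begin
      K * s ^ (μ * N)
        ≡⟨ solve 4 (λ n a b z → (n :* (a :* b)) :* z := n :* (a :* (b :* z))) refl (N !) ((N' !) ^ suc ρ) (((μ * N) !) ^ suc ρ) (s ^ (μ * N)) ⟩
      #configs {N} {N'} {μ * N} {s} {suc ρ}
        ≤⟨ configs-bound X c her speed H XH emb (λ {x} {y} → emb-inj {x} {y}) enc decode ⟩
      tree# * R * (#L ! * c ^ #L)
        ≤⟨ *-mono-≤ (*-monoʳ-≤ tree# R≤) (*-monoˡ-≤ (c ^ #L) (!-parts (suc ρ) N N' (μ * N))) ⟩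
      tree# * Λ ^ #L * ((2 ^ (3 + ρ)) ^ #L * K * c ^ #L)
        ≡⟨ solve 5 (λ T L P K c → T :* L :* (P :* K :* c) := K :* (T :* (P :* (L :* c)))) refl tree# (Λ ^ #L) ((2 ^ (3 + ρ)) ^ #L) K (c ^ #L) ⟩
      K * (tree# * ((2 ^ (3 + ρ)) ^ #L * (Λ ^ #L * c ^ #L)))
        ≡⟨ cong (λ z → K * (tree# * ((2 ^ (3 + ρ)) ^ #L * z))) (sym (^-distribʳ-* #L Λ c)) ⟩
      K * (tree# * ((2 ^ (3 + ρ)) ^ #L * (Λ * c) ^ #L))
        ≡⟨ cong (λ z → K * (tree# * z)) (sym (^-distribʳ-* #L (2 ^ (3 + ρ)) (Λ * c))) ⟩
      K * (tree# * base ^ #L) ∎)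
      where
      open ≤-Reasoning
      open +-*-Solver

-- Bounded average degree (r = 0)

degree : ∀ {n} → Graph (Fin n) → Fin n → ℕ
degree H v = count (adj H v)

total : ∀ {n} → Graph (Fin n) → ℕ
total H = sum (degree H)

degSum≡total : ∀ {n} (H : Graph (Fin n)) → degSum H ≡ total H
degSum≡total {n} H = trans (sum-list n (λ i → i)) (sum-cong-≗ {n} (λ u → count-list n (adj H u) (λ i → i)))
  where
  sum-list : ∀ {A : Set} {h : A → ℕ} k (g : Fin k → A) → List.sum (map h (tabulate g)) ≡ sum (h ∘ g)
  sum-list zero    g = refl
  sum-list (suc k) g = cong (_ +_) (sum-list k (g ∘ suc))
  count-list : ∀ {A : Set} k (p : A → Bool) (g : Fin k → A) →
    length (filter (λ v → Bool.T? (p v)) (tabulate g)) ≡ count (p ∘ g)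
  count-list zero    p g = refl
  count-list (suc k) p g with p (g zero)
  ... | true  = cong suc (count-list k p (g ∘ suc))
  ... | false = count-list k p (g ∘ suc)

total-remove : ∀ {n} (H : Graph (Fin (suc n))) v →
  total H ≡ 2 * degree H v + total (induced H (punchIn v))
total-remove {n} H v = begin
  total H                                                       ≡⟨ sum-remove {i = v} (degree H) ⟩
  degree H v + sum (λ j → degree H (punchIn v j))               ≡⟨ cong (degree H v +_) (sum-cong-≗ {n} (λ j → sum-remove {i = v} (b2n ∘ adj H (punchIn v j)))) ⟩
  degree H v + sum (λ j → back j + degree H' j)                 ≡⟨ cong (degree H v +_) (∑-distrib-+ back (degree H')) ⟩
  degree H v + (sum back + total H')                            ≡⟨ cong (λ z → degree H v + (z + total H')) back≡ ⟩
  degree H v + (degree H v + total H')                          ≡⟨ solve 2 (λ a b → a :+ (a :+ b) := con 2 :* a :+ b) refl (degree H v) (total H') ⟩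
  2 * degree H v + total H'                                     ∎
  where
  open ≡-Reasoning
  open +-*-Solver
  H' = induced H (punchIn v)
  back : Fin n → ℕ
  back j = b2n (adj H (punchIn v j) v)
  back≡ : sum back ≡ degree H v
  back≡ = begin
    sum back                                             ≡⟨ sum-cong-≗ {n} (λ j → cong b2n (adj-sym H (punchIn v j) v)) ⟩
    sum (λ j → b2n (adj H v (punchIn v j)))              ≡⟨ cong (λ b → b2n b + sum (λ j → b2n (adj H v (punchIn v j)))) (sym (irrefl H v)) ⟩
    b2n (adj H v v) + sum (λ j → b2n (adj H v (punchIn v j))) ≡⟨ sym (sum-remove {i = v} (b2n ∘ adj H v)) ⟩
    degree H v                                           ∎

-- Dense graphs that are minimal under vertex deletion

record Critical (X : GraphPred) (d : ℕ) : Set where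
  field
    {n}     : ℕ
    H       : Graph (Fin (suc n))
    H∈X     : X H
    dense   : 2 * d * suc n < total H
    minimal : ∀ v → total H ≤ 2 * d * n + 2 * degree H v

-- Minimality yields both bounds required below: every degree exceeds d, yet the average degree
-- stays within a constant factor of d, so that many vertices have low degree.
critical : (X : GraphPred) → Hereditary X → ∀ d {n} (H : Graph (Fin n)) → X H → 2 * d * n < total H → Critical X d
critical X her d {zero}  H XH dense = contradiction dense λ ()
critical X her d {suc n} H XH dense with any? (λ v → 2 * d * n <? total (induced H (punchIn v)))
... | yes (v , dense') = critical X her d (induced H (punchIn v)) (her H (punchIn v) (punchIn-injective v _ _) XH) dense'
... | no ¬dense' = record { H = H ; H∈X = XH ; dense = dense ; minimal = λ v → begin
    total H                                             ≡⟨ total-remove H v ⟩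
    2 * degree H v + total (induced H (punchIn v))      ≤⟨ +-monoʳ-≤ (2 * degree H v) (≮⇒≥ (λ lt → ¬dense' (v , lt))) ⟩
    2 * degree H v + 2 * d * n                          ≡⟨ +-comm (2 * degree H v) _ ⟩
    2 * d * n + 2 * degree H v                          ∎ }
  where open ≤-Reasoning

module CriticalBounds {X : GraphPred} {d : ℕ} (1≤d : 1 ≤ d) (𝒞 : Critical X d) where
  open Critical 𝒞

  min-degree : ∀ v → d < degree H v
  min-degree v = *-cancelˡ-< 2 d (degree H v) (+-cancelˡ-< (2 * d * n) _ _ (begin-strict
    2 * d * n + 2 * d           ≡⟨ trans (+-comm (2 * d * n) (2 * d)) (sym (*-suc (2 * d) n)) ⟩
    2 * d * suc n               <⟨ dense ⟩
    total H                     ≤⟨ minimal v ⟩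
    2 * d * n + 2 * degree H v  ∎))
    where open ≤-Reasoning

  -- Summed over all v, `minimal` bounds suc n times the total by a main term plus twice the total.
  -- From four vertices on, that excess is at most half of the left side; with at most three
  -- vertices every degree is at most 3.
  total-≤ : total H ≤ 4 * d * suc n
  total-≤ = go (suc n ≤? 3)
    where
    open ≤-Reasoning
    open +-*-Solver
    go : Dec (suc n ≤ 3) → total H ≤ 4 * d * suc n
    go (yes n≤3) = begin
      total H                     ≤⟨ sum-mono (degree H) (λ _ → 4 * d) (λ v → ≤-trans (count≤n (adj H v))
                                       (≤-trans n≤3 (≤-trans (n≤1+n 3) (*-monoʳ-≤ 4 1≤d)))) ⟩
      sum {suc n} (λ _ → 4 * d)   ≡⟨ trans (sum-const (suc n) (4 * d)) (*-comm (suc n) (4 * d)) ⟩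
      4 * d * suc n               ∎
    go (no n≰3) = ≤-trans (*-cancelˡ-≤ (suc n) (+-cancelʳ-≤ (4 * total H) _ _ (begin
      suc n * total H + 4 * total H                         ≤⟨ +-monoʳ-≤ (suc n * total H) (*-monoˡ-≤ (total H) (≰⇒> n≰3)) ⟩
      suc n * total H + suc n * total H                     ≡⟨ solve 2 (λ a b → a :* b :+ a :* b := con 2 :* (a :* b)) refl (suc n) (total H) ⟩
      2 * (suc n * total H)                                 ≤⟨ *-monoʳ-≤ 2 summed ⟩
      2 * (suc n * (2 * d * n) + 2 * total H)               ≡⟨ solve 4 (λ a d n t → con 2 :* (a :* (con 2 :* d :* n) :+ con 2 :* t) := a :* (con 4 :* d :* n) :+ con 4 :* t) refl (suc n) d n (total H) ⟩
      suc n * (4 * d * n) + 4 * total H                     ∎))) (*-monoʳ-≤ (4 * d) (n≤1+n n))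
      where
      summed : suc n * total H ≤ suc n * (2 * d * n) + 2 * total H
      summed = begin
        suc n * total H                                       ≡⟨ sym (sum-const (suc n) (total H)) ⟩
        sum {suc n} (λ _ → total H)                           ≤⟨ sum-mono {suc n} (λ _ → total H) _ minimal ⟩
        sum {suc n} (λ v → 2 * d * n + 2 * degree H v)        ≡⟨ ∑-distrib-+ {suc n} (λ _ → 2 * d * n) (λ v → 2 * degree H v) ⟩
        sum {suc n} (λ _ → 2 * d * n) + sum {suc n} (λ v → 2 * degree H v)
          ≡⟨ cong₂ _+_ (sum-const (suc n) (2 * d * n)) (sym (*-distribˡ-sum 2 (degree H))) ⟩
        suc n * (2 * d * n) + 2 * total H                     ∎

  low : Fin (suc n) → Bool
  low v = does (degree H v ≤? 8 * d)

  -- The average degree is at most 4 d, so at most half of the vertices have degree above 8 d.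
  low-many : suc n ≤ 2 * count low
  low-many = +-cancelʳ-≤ (2 * count high) _ _ (begin
    suc n + 2 * count high                 ≤⟨ +-monoʳ-≤ (suc n) high-few ⟩
    suc n + suc n                          ≡⟨ solve 1 (λ a → a :+ a := con 2 :* a) refl (suc n) ⟩
    2 * suc n                              ≡⟨ cong (2 *_) (trans (sym (count-all (suc n))) (count-split (λ _ → true) low)) ⟩
    2 * (count low + count high)           ≡⟨ *-distribˡ-+ 2 (count low) (count high) ⟩
    2 * count low + 2 * count high         ∎)
    where
    open ≤-Reasoning
    open +-*-Solver
    high : Fin (suc n) → Bool
    high v = not (low v)
    instance
      4d≢0 : NonZero (4 * d)
      4d≢0 = m*n≢0 4 d {{_}} {{>-nonZero 1≤d}}
    high-deg : ∀ v → 8 * d * b2n (high v) ≤ degree H v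
    high-deg v = go (degree H v ≤? 8 * d)
      where
      go : (p : Dec (degree H v ≤ 8 * d)) → 8 * d * b2n (not (does p)) ≤ degree H v
      go (yes _) = ≤-trans (≤-reflexive (*-zeroʳ (8 * d))) z≤n
      go (no ¬p) = ≤-trans (≤-reflexive (*-identityʳ (8 * d))) (<⇒≤ (≰⇒> ¬p))
    high-few : 2 * count high ≤ suc n
    high-few = *-cancelˡ-≤ (4 * d) (begin
      4 * d * (2 * count high)                ≡⟨ solve 2 (λ d h → con 4 :* d :* (con 2 :* h) := con 8 :* d :* h) refl d (count high) ⟩
      8 * d * count high                      ≡⟨ *-distribˡ-sum (8 * d) (b2n ∘ high) ⟩
      sum (λ v → 8 * d * b2n (high v))        ≤⟨ sum-mono _ (degree H) high-deg ⟩
      total H                                 ≤⟨ total-≤ ⟩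
      4 * d * suc n                           ∎)

-- Greedy choice of a small set in which many low vertices have t neighbours

module Dominating {n : ℕ} (H : Graph (Fin n)) (low : Fin n → Bool) (t g : ℕ) (1≤g : 1 ≤ g)
  (large : ∀ u → t + 4 * g ≤ degree H u) where

  nbrs : (Fin n → Bool) → Fin n → ℕ
  nbrs A u = count (λ v → adj H u v ∧ A v)

  poor rich : (Fin n → Bool) → Fin n → Bool
  poor A u = low u ∧ does (nbrs A u <? t)
  rich A u = (low u ∧ not (does (nbrs A u <? t))) ∧ not (A u)

  -- The deficit of a low vertex; its sum is the potential that the greedy choice consumes.
  need : (Fin n → Bool) → Fin n → ℕ
  need A u = b2n (low u) * (t ∸ nbrs A u)

  gain : (Fin n → Bool) → Fin n → ℕ
  gain A x = count (λ u → poor A u ∧ adj H u x)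

  -- A poor vertex has at least t + 4 g neighbours and fewer than t of them in `A`, hence at least 4
  -- g outside. With more than n / 4 poor vertices, some vertex outside `A` receives more than g on
  -- average.
  useful-vertex : ∀ A → n < 4 * count (poor A) → ∃ λ x → A x ≡ false × g < gain A x
  useful-vertex A many with exceeds-average g (λ x → sum (term x)) (begin-strict
      n * g                                  <⟨ *-monoˡ-< g {{>-nonZero 1≤g}} many ⟩
      4 * count (poor A) * g                 ≡⟨ solve 2 (λ p g → con 4 :* p :* g := con 4 :* g :* p) refl (count (poor A)) g ⟩
      4 * g * count (poor A)                 ≡⟨ *-distribˡ-sum (4 * g) (b2n ∘ poor A) ⟩
      sum (λ u → 4 * g * b2n (poor A u))     ≤⟨ sum-mono _ (λ u → sum (λ x → term x u)) outside ⟩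
      sum (λ u → sum (λ x → term x u))       ≡⟨ ∑-comm (λ u x → term x u) ⟩
      sum (λ x → sum (term x))               ∎)
    where
    open ≤-Reasoning
    open +-*-Solver
    term : Fin n → Fin n → ℕ
    term x u = b2n (not (A x) ∧ (poor A u ∧ adj H u x))
    out : ∀ u → nbrs A u < t → 4 * g ≤ count (λ x → not (A x) ∧ adj H u x)
    out u lt = +-cancelˡ-≤ t _ _ (begin
      t + 4 * g                                                    ≤⟨ large u ⟩
      degree H u                                                   ≡⟨ count-split (adj H u) A ⟩
      nbrs A u + count (λ x → adj H u x ∧ not (A x))               ≤⟨ +-mono-≤ (<⇒≤ lt) (≤-reflexive (count-cong (λ x → adj H u x ∧ not (A x)) (λ x → not (A x) ∧ adj H u x) (λ x → Bool.∧-comm (adj H u x) (not (A x))))) ⟩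
      t + count (λ x → not (A x) ∧ adj H u x)                      ∎)
    outside : ∀ u → 4 * g * b2n (poor A u) ≤ sum (λ x → term x u)
    outside u with poor A u in eq
    ... | false = ≤-trans (≤-reflexive (*-zeroʳ (4 * g))) z≤n
    ... | true  = ≤-trans (≤-reflexive (*-identityʳ (4 * g))) (out u (does-true (nbrs A u <? t) (∧-trueʳ {low u} eq)))
  ... | x , big = x , not-true (go (not (A x)) big) , ≤-trans big (count-mono _ (λ u → poor A u ∧ adj H u x) (λ u p → ∧-trueʳ {not (A x)} p))
    where
    go : ∀ b → g < count (λ u → b ∧ (poor A u ∧ adj H u x)) → b ≡ true
    go true  _ = refl
    go false h = contradiction (≤-trans h (≤-reflexive (trans (sum-const n 0) (*-zeroʳ n)))) λ ()

  _⊕_ : (Fin n → Bool) → Fin n → Fin n → Bool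
  (A ⊕ x) v = A v ∨ does (x ≟ v)

  count-⊕ : ∀ A x → count (A ⊕ x) ≤ suc (count A)
  count-⊕ A x = ≤-trans (≤-reflexive (count-⊖ (A ⊕ x) x self))
      (s≤s (count-mono ((A ⊕ x) ⊖ x) A (λ v p → back v (∧-trueˡ p) (⊖-≢ {f = A ⊕ x} {x} {v} p))))
    where
    self : (A ⊕ x) x ≡ true
    self = trans (cong (A x ∨_) (dec-true (x ≟ x) refl)) (Bool.∨-zeroʳ (A x))
    back : ∀ v → (A ⊕ x) v ≡ true → x ≢ v → A v ≡ true
    back v p x≢v = trans (sym (trans (cong (A v ∨_) (dec-false (x ≟ v) x≢v)) (Bool.∨-identityʳ (A v)))) p

  nbrs-⊕ : ∀ A x u → A x ≡ false → nbrs A u + b2n (adj H u x) ≤ nbrs (A ⊕ x) u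
  nbrs-⊕ A x u Ax with adj H u x in eq
  ... | false = ≤-trans (≤-reflexive (+-identityʳ _)) (count-mono (λ v → adj H u v ∧ A v) (λ v → adj H u v ∧ (A ⊕ x) v)
                  (λ v p → ∧-true (∧-trueˡ p) (cong (_∨ does (x ≟ v)) (∧-trueʳ {adj H u v} p))))
  ... | true  = ≤-trans (≤-reflexive (+-comm _ 1)) (≤-trans (s≤s (count-mono (λ v → adj H u v ∧ A v) (f ⊖ x)
                  (λ v p → ⊖-true {f = f} {x} {v} (∧-true (∧-trueˡ p) (cong (_∨ does (x ≟ v)) (∧-trueʳ {adj H u v} p)))
                    (λ { refl → true≢false (∧-trueʳ {adj H u v} p) Ax }))))
                  (≤-reflexive (sym (count-⊖ f x (∧-true eq (trans (cong (A x ∨_) (dec-true (x ≟ x) refl)) (Bool.∨-zeroʳ (A x))))))))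
    where
    f : Fin n → Bool
    f v = adj H u v ∧ (A ⊕ x) v

  need-⊕ : ∀ A x u → A x ≡ false → need (A ⊕ x) u + b2n (poor A u ∧ adj H u x) ≤ need A u
  need-⊕ A x u Ax = go (low u) (nbrs A u <? t) (adj H u x) (nbrs-⊕ A x u Ax)
    where
    go : ∀ l {c c'} (d : Dec (c < t)) b → c + b2n b ≤ c' →
      b2n l * (t ∸ c') + b2n ((l ∧ does d) ∧ b) ≤ b2n l * (t ∸ c)
    go false d b h = z≤n
    go true {c} {c'} (yes c<t) true h = begin
      1 * (t ∸ c') + 1        ≡⟨ cong (_+ 1) (*-identityˡ (t ∸ c')) ⟩
      t ∸ c' + 1              ≤⟨ +-monoˡ-≤ 1 (∸-monoʳ-≤ t (≤-trans (≤-reflexive (+-comm 1 c)) h)) ⟩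
      t ∸ suc c + 1           ≡⟨ trans (+-comm _ 1) (sym (+-∸-assoc 1 c<t)) ⟩
      t ∸ c                   ≡⟨ sym (*-identityˡ (t ∸ c)) ⟩
      1 * (t ∸ c)             ∎
      where open ≤-Reasoning
    go true {c} {c'} (yes c<t) false h = ≤-trans (≤-reflexive (+-identityʳ _)) (*-monoʳ-≤ 1 (∸-monoʳ-≤ t (≤-trans (m≤m+n c 0) h)))
    go true {c} {c'} (no _) b h = ≤-trans (≤-reflexive (+-identityʳ _)) (*-monoʳ-≤ 1 (∸-monoʳ-≤ t (≤-trans (m≤m+n c (b2n b)) h)))

  -- Each new vertex of `A` lowers the total need by more than g, so |A| g plus the total need never
  -- rises above its initial bound t n; the need also serves as termination measure.
  greedy : ∀ m A → sum (need A) ≤ m → count A * g + sum (need A) ≤ t * n →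
    ∃ λ A → count A * g ≤ t * n × 4 * count (poor A) ≤ n
  greedy m A Need≤m inv = decide (4 * count (poor A) ≤? n)
    where
    module Step (useful : ∃ λ x → A x ≡ false × g < gain A x) where
      open ≤-Reasoning
      open +-*-Solver
      x = proj₁ useful
      A' = A ⊕ x
      drop : sum (need A') + suc g ≤ sum (need A)
      drop = begin
        sum (need A') + suc g                                          ≤⟨ +-monoʳ-≤ (sum (need A')) (proj₂ (proj₂ useful)) ⟩
        sum (need A') + gain A x                                       ≡⟨ sym (∑-distrib-+ (need A') (λ u → b2n (poor A u ∧ adj H u x))) ⟩
        sum (λ u → need A' u + b2n (poor A u ∧ adj H u x))             ≤⟨ sum-mono _ (need A) (λ u → need-⊕ A x u (proj₁ (proj₂ useful))) ⟩
        sum (need A)                                                   ∎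
      next : ∀ m → sum (need A) ≤ m → ∃ λ A → count A * g ≤ t * n × 4 * count (poor A) ≤ n
      next zero    le = contradiction (≤-trans (≤-trans (m≤n+m (suc g) _) drop) le) λ ()
      next (suc m) le = greedy m A' (s≤s⁻¹ (begin
          suc (sum (need A'))     ≡⟨ +-comm 1 _ ⟩
          sum (need A') + 1       ≤⟨ +-monoʳ-≤ (sum (need A')) (s≤s z≤n) ⟩
          sum (need A') + suc g   ≤⟨ ≤-trans drop le ⟩
          suc m                   ∎))
        (begin
          count A' * g + sum (need A')          ≤⟨ +-monoˡ-≤ _ (*-monoˡ-≤ g (count-⊕ A x)) ⟩
          g + count A * g + sum (need A')       ≡⟨ solve 3 (λ g a b → g :+ a :+ b := a :+ (b :+ g)) refl g (count A * g) (sum (need A')) ⟩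
          count A * g + (sum (need A') + g)     ≤⟨ +-monoʳ-≤ (count A * g) (≤-trans (+-monoʳ-≤ (sum (need A')) (n≤1+n g)) drop) ⟩
          count A * g + sum (need A)            ≤⟨ inv ⟩
          t * n                                 ∎)
    decide : Dec (4 * count (poor A) ≤ n) → ∃ λ A → count A * g ≤ t * n × 4 * count (poor A) ≤ n
    decide (yes few) = A , ≤-trans (m≤m+n _ _) inv , few
    decide (no many) = Step.next (useful-vertex A (≰⇒> many)) m Need≤m

  -- Of at least n / 2 low vertices at most n / 4 stay poor, and each of the others lies in `A` or
  -- is rich.
  dominating-set : n ≤ 2 * count low → ∃ λ A → count A * g ≤ t * n × n ≤ 4 * (count A + count (rich A))
  dominating-set low-many with greedy (sum (need ∅)) ∅ ≤-refl start
    where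
    ∅ : Fin n → Bool
    ∅ _ = false
    start : count ∅ * g + sum (need ∅) ≤ t * n
    start = ≤-trans (+-mono-≤ (≤-reflexive (cong (_* g) (trans (sum-const n 0) (*-zeroʳ n))))
        (sum-mono (need ∅) (λ _ → t) (λ u → ≤-trans (*-mono-≤ (b2n≤1 (low u)) (m∸n≤m t (nbrs ∅ u))) (≤-reflexive (*-identityˡ t)))))
      (≤-reflexive (trans (sum-const n t) (*-comm n t)))
  ... | A , small , few = A , small , +-cancelˡ-≤ n _ _ (begin
      n + n                                        ≡⟨ solve 1 (λ n → n :+ n := con 2 :* n) refl n ⟩
      2 * n                                        ≤⟨ *-monoʳ-≤ 2 low-many ⟩
      2 * (2 * count low)                          ≡⟨ solve 1 (λ l → con 2 :* (con 2 :* l) := con 4 :* l) refl (count low) ⟩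
      4 * count low                                ≡⟨ cong (4 *_) (count-split low (λ u → does (nbrs A u <? t))) ⟩
      4 * (count (poor A) + count served)          ≡⟨ *-distribˡ-+ 4 (count (poor A)) _ ⟩
      4 * count (poor A) + 4 * count served        ≤⟨ +-mono-≤ few (*-monoʳ-≤ 4 served≤) ⟩
      n + 4 * (count A + count (rich A))           ∎)
    where
    open ≤-Reasoning
    open +-*-Solver
    served : Fin n → Bool
    served u = low u ∧ not (does (nbrs A u <? t))
    served≤ : count served ≤ count A + count (rich A)
    served≤ = ≤-trans (≤-reflexive (count-split served A))
      (+-monoˡ-≤ (count (rich A)) (count-mono (λ u → served u ∧ A u) A (λ u p → ∧-trueʳ {served u} p)))

-- Links that are single vertices, and the absence of large bicliques

BicliqueFree : GraphPred → ℕ → Set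
BicliqueFree X t = ∀ n (G : Graph (Fin n)) → X G → ¬ (_⊆ᵍ_ {Fin t ⊎ Fin t} {Fin n} (Ktt t) (adj G))

≡⇒T : ∀ {b} → b ≡ true → T b
≡⇒T refl = _

T⇒≡ : ∀ {b} → T b → b ≡ true
T⇒≡ {true} _ = refl

-- More than t common neighbours contain one side of a K_{t,t}, and t of the `v i` form the other;
-- the sides are disjoint as no vertex is its own neighbour. Taking `suc t` vertices keeps the edges
-- of `Hypergraph` nonempty even if t = 0.
few-common-neighbours : (X : GraphPred) → ∀ {t} → BicliqueFree X t → ∀ {m} (H : Graph (Fin m)) → X H →
  (v : Fin (suc t) → Fin m) → Injective _≡_ _≡_ v →
  (Y : Fin m → Bool) → (∀ y → Y y ≡ true → ∀ i → adj H y (v i) ≡ true) → count Y ≤ t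
few-common-neighbours X {t} free {m} H XH v v-inj Y common = ≮⇒≥ λ t<|Y| → free m H XH (φ t<|Y| , φ-inj t<|Y| , edge t<|Y|)
  where
  module _ (t<|Y| : t < count Y) where
    y : Fin t → Fin m
    y i = enum Y (inject≤ i (<⇒≤ t<|Y|))
    y-adj : ∀ i j → adj H (y i) (v j) ≡ true
    y-adj i j = common (y i) (enum-true Y _) j
    φ : Fin t ⊎ Fin t → Fin m
    φ (inj₁ i) = y i
    φ (inj₂ j) = v (inject₁ j)
    apart : ∀ i j → y i ≢ v (inject₁ j)
    apart i j eq = true≢false (trans (cong (λ z → adj H z (v (inject₁ j))) (sym eq)) (y-adj i (inject₁ j))) (irrefl H (v (inject₁ j)))
    φ-inj : Injective _≡_ _≡_ φ
    φ-inj {inj₁ i} {inj₁ j} eq = cong inj₁ (inject≤-injective _ _ i j (enum-injective Y _ _ eq))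
    φ-inj {inj₂ i} {inj₂ j} eq = cong inj₂ (inject₁-injective (v-inj eq))
    φ-inj {inj₁ i} {inj₂ j} eq = contradiction eq (apart i j)
    φ-inj {inj₂ j} {inj₁ i} eq = contradiction (sym eq) (apart i j)
    edge : ∀ x z → T (Ktt t x z) → T (adj H (φ x) (φ z))
    edge (inj₁ i) (inj₂ j) _ = ≡⇒T (y-adj i (inject₁ j))
    edge (inj₂ j) (inj₁ i) _ = ≡⇒T (trans (adj-sym H _ _) (y-adj i (inject₁ j)))

-- A vertex outside the tree is known, up to its rank among fewer than t candidates,
-- once its neighbours among the branch vertices are.
module VertexLinks (X : GraphPred) {c t : ℕ} (1≤c : 1 ≤ c) (her : Hereditary X) (speed : HasSpeed X c)
  (free : BicliqueFree X t) {m n e : ℕ} (H : Graph (Fin m)) (H∈X : X H)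
  (a : Fin n → Fin m) (a-inj : Injective _≡_ _≡_ a) (b : Fin e → Fin m) (b-inj : Injective _≡_ _≡_ b)
  (a≢b : ∀ i x → a i ≢ b x) (ends : Fin e → Fin (suc t) → Fin n) (ends-inj : ∀ x → Injective _≡_ _≡_ (ends x))
  (ends-adj : ∀ x i → adj H (b x) (a (ends x i)) ≡ true) where

  I : Fin e → Fin n → Bool
  I x v = adj H (b x) (a v)

  vert : Fin n ⊎ (Fin 1 × Fin e) → Fin m
  vert (inj₁ i)       = a i
  vert (inj₂ (_ , x)) = b x

  vert-inj : Injective _≡_ _≡_ vert
  vert-inj {inj₁ i} {inj₁ j} eq = cong inj₁ (a-inj eq)
  vert-inj {inj₁ i} {inj₂ (_ , x)} eq = contradiction eq (a≢b i x)
  vert-inj {inj₂ (_ , x)} {inj₁ i} eq = contradiction (sym eq) (a≢b i x)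
  vert-inj {inj₂ (zero , x)} {inj₂ (zero , y)} eq = cong (λ z → inj₂ (zero , z)) (b-inj eq)

  module _ {Δ D μ s : ℕ} (sel : Selection ends I Δ D μ s) where
    open Selection sel
    open Embedded H vert vert-inj sel

    branch : Conf → Fin N → Fin m
    branch C l = a (α (π C ⟨$⟩ʳ l))

    chosen : Conf → Fin (μ * N) → Fin e
    chosen C q = δ (σ C zero ⟨$⟩ʳ q) (pick C (σ C zero ⟨$⟩ʳ q))

    Fits : Conf → Fin (μ * N) → Fin m → Set
    Fits C q y = ∀ l → adj H (b (chosen C q)) (branch C l) ≡ true → adj H y (branch C l) ≡ true

    fits? : ∀ C q y → Dec (Fits C q y)
    fits? C q y = all? (λ l → (adj H (b (chosen C q)) (branch C l) Bool.≟ true) →-dec (adj H y (branch C l) Bool.≟ true))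

    -- Taken among all vertices of the fixed graph `H`, so that the set depends only on the branch
    -- vertices and the visible adjacencies. The chosen vertex sees t + 1 ends, so all candidates
    -- are common neighbours of these.
    candidates : Conf → Fin (μ * N) → Fin m → Bool
    candidates C q y = does (fits? C q y)

    chosen-fits : ∀ C q → candidates C q (b (chosen C q)) ≡ true
    chosen-fits C q = dec-true (fits? C q _) (λ _ h → h)

    candidates-few : ∀ C q → count (candidates C q) ≤ t
    candidates-few C q = few-common-neighbours X free H H∈X (λ i → a (ends x i)) (λ eq → ends-inj x (a-inj eq))
        (candidates C q) (λ y fit i → subst (λ z → adj H y z ≡ true) (at i)
          (does-true (fits? C q y) fit (label i) (subst (λ z → adj H (b x) z ≡ true) (sym (at i)) (ends-adj x i))))
      where
      x = chosen C q
      end : ∀ i → ∃ λ v → α v ≡ ends x i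
      end i = δ-ends _ _ i
      label : Fin (suc t) → Fin N
      label i = π C ⟨$⟩ˡ proj₁ (end i)
      at : ∀ i → branch C (label i) ≡ a (ends x i)
      at i = cong a (trans (cong α (inverseʳ (π C))) (proj₂ (end i)))

    light : Conf → Fin (suc t ^ (μ * N))
    light C = funToFin (λ q → pointer t (candidates C q) (b (chosen C q)))

    all-same : ∀ C C' → light C ≡ light C' → Pattern C C' → SameCore C C' → C ≈ C'
    all-same C C' leq same (π≡ , κ≡) = record
      { π≈ = π≡
      ; κ≈ = λ { zero p → κ≡ p }
      ; σ≈ = λ { zero q → proj₁ (chosen≡ q) }
      -- The light code speaks of labels: the choice in block r is read at the label that `σ C zero`
      -- sends to r.
      ; pick≈ = λ r → trans (cong (pick C) (sym (inverseʳ (σ C zero)))) (trans (proj₂ (chosen≡ (σ C zero ⟨$⟩ˡ r)))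
                  (cong (pick C') (trans (sym (proj₁ (chosen≡ (σ C zero ⟨$⟩ˡ r)))) (inverseʳ (σ C zero)))))
      }
      where
      branch≡ : ∀ l → branch C l ≡ branch C' l
      branch≡ l = cong (a ∘ α) (π≡ l)
      adj≡ : ∀ q l → adj H (b (chosen C q)) (branch C l) ≡ adj H (b (chosen C' q)) (branch C' l)
      adj≡ q l = same (inj₂ (inj₂ (zero , q))) (inj₁ l)
      candidates≡ : ∀ q → candidates C q ≗ candidates C' q
      candidates≡ q y = does-⇔ (mk⇔
        (λ fit l h → subst (λ z → adj H y z ≡ true) (branch≡ l) (fit l (trans (adj≡ q l) h)))
        (λ fit l h → subst (λ z → adj H y z ≡ true) (sym (branch≡ l)) (fit l (trans (sym (adj≡ q l)) h))))
        (fits? C q y) (fits? C' q y)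
      chosen≡ : ∀ q → σ C zero ⟨$⟩ʳ q ≡ σ C' zero ⟨$⟩ʳ q × pick C (σ C zero ⟨$⟩ʳ q) ≡ pick C' (σ C' zero ⟨$⟩ʳ q)
      chosen≡ q = δ-inj (b-inj (pointer-injective t (candidates≡ q) (candidates-few C q)
        (chosen-fits C q) (chosen-fits C' q) (funToFin-injective leq q)))

    vertex-links-impossible : 1 ≤ μ → (suc Δ * suc (suc D)) * suc Δ < 2 ^ μ →
      s ≡ 2 * (2 ^ 3 * (suc t * c)) ^ 3 → ⊥
    vertex-links-impossible = impossible X c 1≤c her speed H∈X light (suc t) (s≤s z≤n)
      (^-monoʳ-≤ (suc t) (≤-trans (≤-reflexive (sym (+-identityʳ (μ * N)))) (≤-trans (m≤n+m _ (1 * N')) (m≤n+m _ N))))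
      (λ C C' _ same p v → same (inj₂ (inj₁ (zero , p))) (inj₁ v)) all-same

-- Constants of the sparse case: 2 ^ μ outgrows the tree cost, which is cubic in μ.
record Parameters (t s : ℕ) : Set where
  field
    μ D g d : ℕ
    1≤μ     : 1 ≤ μ
    1≤g     : 1 ≤ g
    D-large : suc t * suc (s * μ) ≤ D
    g-large : 4 * suc t * suc (suc D) ≤ g
    d-large : suc t + 4 * g ≤ d
    cost    : (suc (8 * d) * suc (suc D)) * suc (8 * d) < 2 ^ μ

-- D + 2 and 8 d + 1 are at most a₁ (μ + 1) and a₂ (μ + 1), so μ is obtained from
-- `cubic<exponential` for the coefficient a₂ a₁ a₂. Variables with defining equations keep the
-- constants opaque.
parameters : ∀ t s → Parameters t s
parameters t s = build (suc t * suc s + 2) (8 * (suc t + 16 * (suc t * (suc t * suc s + 2))) + 1) refl refl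
  where
  open ≤-Reasoning
  open +-*-Solver
  positive : ∀ μ x y → 1 ≤ y → 1 ≤ x → y * x * y * (suc μ * (suc μ * suc μ)) < 2 ^ μ → 1 ≤ μ
  positive zero    x y 1≤y 1≤x lt = contradiction (*-mono-≤ (*-mono-≤ (*-mono-≤ 1≤y 1≤x) 1≤y) (≤-refl {1})) (<⇒≱ lt)
  positive (suc μ) x y _ _ _ = s≤s z≤n
  D≤ : ∀ T s μ → suc (suc (T * suc (s * μ))) ≤ (T * suc s + 2) * suc μ
  D≤ T s μ = ≤-trans (m≤m+n _ (T * μ + T * s + 2 * μ)) (≤-reflexive
    (solve 3 (λ T s m → con 2 :+ T :* (con 1 :+ s :* m) :+ (T :* m :+ T :* s :+ con 2 :* m)
              := (T :* (con 1 :+ s) :+ con 2) :* (con 1 :+ m)) refl T s μ))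
  d≤ : ∀ T a μ D → suc (suc D) ≤ a * suc μ →
    suc (8 * (T + 4 * (4 * T * suc (suc D)))) ≤ (8 * (T + 16 * (T * a)) + 1) * suc μ
  d≤ T a μ D D≤ = begin
    suc (8 * (T + 4 * (4 * T * suc (suc D))))
      ≤⟨ s≤s (*-monoʳ-≤ 8 (+-monoʳ-≤ T (*-monoʳ-≤ 4 (*-monoʳ-≤ (4 * T) D≤)))) ⟩
    suc (8 * (T + 4 * (4 * T * (a * suc μ))))
      ≤⟨ m≤m+n _ ((8 * T + 1) * μ) ⟩
    suc (8 * (T + 4 * (4 * T * (a * suc μ)))) + (8 * T + 1) * μ
      ≡⟨ solve 3 (λ T a m → con 1 :+ con 8 :* (T :+ con 4 :* (con 4 :* T :* (a :* (con 1 :+ m)))) :+ (con 8 :* T :+ con 1) :* m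
            := (con 8 :* (T :+ con 16 :* (T :* a)) :+ con 1) :* (con 1 :+ m)) refl T a μ ⟩
    (8 * (T + 16 * (T * a)) + 1) * suc μ ∎
  product : ∀ x y x' y' μ → x ≤ x' * suc μ → y ≤ y' * suc μ → (x * y) * x ≤ x' * y' * x' * (suc μ * (suc μ * suc μ))
  product x y x' y' μ x≤ y≤ = ≤-trans (*-mono-≤ (*-mono-≤ x≤ y≤) x≤) (≤-reflexive
    (solve 3 (λ a b m → (a :* m :* (b :* m)) :* (a :* m) := a :* b :* a :* (m :* (m :* m))) refl x' y' (suc μ)))
  build : ∀ a₁ a₂ → suc t * suc s + 2 ≡ a₁ → 8 * (suc t + 16 * (suc t * a₁)) + 1 ≡ a₂ → Parameters t s
  build a₁ a₂ e₁ e₂ = assemble _ _ _ refl refl refl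
    where
    μ = proj₁ (cubic<exponential (a₂ * a₁ * a₂))
    fast = proj₂ (cubic<exponential (a₂ * a₁ * a₂))
    1≤a₁ : 1 ≤ a₁
    1≤a₁ = subst (1 ≤_) e₁ (≤-trans (s≤s z≤n) (m≤n+m 2 (suc t * suc s)))
    1≤a₂ : 1 ≤ a₂
    1≤a₂ = subst (1 ≤_) e₂ (m≤n+m 1 (8 * (suc t + 16 * (suc t * a₁))))
    assemble : ∀ D g d → suc t * suc (s * μ) ≡ D → 4 * suc t * suc (suc D) ≡ g → suc t + 4 * g ≡ d → Parameters t s
    assemble D g d eD eg ed = record
      { 1≤μ     = positive μ a₁ a₂ 1≤a₂ 1≤a₁ fast
      ; 1≤g     = subst (1 ≤_) eg (s≤s z≤n)
      ; D-large = ≤-reflexive eD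
      ; g-large = ≤-reflexive eg
      ; d-large = ≤-reflexive ed
      ; cost    = ≤-<-trans (product _ _ a₂ a₁ μ bound-d bound-D) fast
      }
      where
      bound-D : suc (suc D) ≤ a₁ * suc μ
      bound-D = subst₂ (λ x y → suc (suc x) ≤ y * suc μ) eD e₁ (D≤ (suc t) s μ)
      bound-d : suc (8 * d) ≤ a₂ * suc μ
      bound-d = subst₂ (λ x y → suc (8 * x) ≤ y * suc μ) (trans (cong (λ z → suc t + 4 * z) eg) ed) e₂ (d≤ (suc t) a₁ μ D bound-D)

module DegreeBound (X : GraphPred) {c t s : ℕ} (1≤c : 1 ≤ c) (her : Hereditary X) (speed : HasSpeed X c)
  (free : BicliqueFree X t) (s≡ : s ≡ 2 * (2 ^ 3 * (suc t * c)) ^ 3) (params : Parameters t s) where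

  open Parameters params

  private
    1≤d : 1 ≤ d
    1≤d = ≤-trans (s≤s z≤n) d-large

  module NoCritical (𝒞 : Critical X d) where
    open Critical 𝒞
    open CriticalBounds 1≤d 𝒞
    open Dominating H low (suc t) g 1≤g (λ u → ≤-trans d-large (<⇒≤ (min-degree u))) public

    -- The hypergraph lives on `A`; each rich vertex is an edge formed by t + 1 of its neighbours in
    -- `A`.
    absurd : (A : Fin (suc n) → Bool) → count A * g ≤ suc t * suc n → suc n ≤ 4 * (count A + count (rich A)) → ⊥
    absurd A small cover = VertexLinks.vertex-links-impossible X 1≤c her speed free H H∈X
        (enum A) (λ {i} {j} → enum-injective A i j) (enum B) (λ {x} {y} → enum-injective B x y) apart ends
        ends-inj (λ x i → enum-true (row x) (inject≤ i (rows x)))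
        (selection-exists ends row
          (λ x i → enum-true (row x) (inject≤ i (rows x))) (8 * d) row-few D μ s D-large many)
        1≤μ cost s≡
      where
      open ≤-Reasoning
      open +-*-Solver
      B = rich A
      -- All neighbours in `A` and not just the t + 1 chosen ones, since the labelled graph does not
      -- tell them apart. Rich vertices are low, which gives Δ = 8 d.
      row : Fin (count B) → Fin (count A) → Bool
      row x i = adj H (enum B x) (enum A i)
      B-true : ∀ x → rich A (enum B x) ≡ true
      B-true = enum-true B
      B-low : ∀ x → low (enum B x) ≡ true
      B-low x = ∧-trueˡ (∧-trueˡ (B-true x))
      rows : ∀ x → suc t ≤ count (row x)
      rows x = ≤-trans (≮⇒≥ (does-false (nbrs A u <? suc t) (not-true (∧-trueʳ {low u} (∧-trueˡ (B-true x))))))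
          (count-injective (λ v → adj H u v ∧ A v) (row x) (λ v p → proj₁ (index-of v p))
            (λ v w p q eq → trans (sym (proj₂ (index-of v p))) (trans (cong (enum A) eq) (proj₂ (index-of w q))))
            (λ v p → trans (cong (adj H u) (proj₂ (index-of v p))) (∧-trueˡ p)))
        where
        u = enum B x
        index-of : ∀ v → adj H u v ∧ A v ≡ true → ∃ λ i → enum A i ≡ v
        index-of v p = enum-surjective A v (∧-trueʳ {adj H u v} p)
      row-few : ∀ x → count (row x) ≤ 8 * d
      row-few x = ≤-trans (count-injective (row x) (adj H (enum B x)) (λ i _ → enum A i) (λ i j _ _ → enum-injective A i j) (λ _ p → p))
        (does-true (degree H (enum B x) ≤? 8 * d) (B-low x))
      ends : Fin (count B) → Fin (suc t) → Fin (count A)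
      ends x i = enum (row x) (inject≤ i (rows x))
      ends-inj : ∀ x → Injective _≡_ _≡_ (ends x)
      ends-inj x {i} {j} eq = inject≤-injective (rows x) (rows x) i j (enum-injective (row x) _ _ eq)
      apart : ∀ i x → enum A i ≢ enum B x
      apart i x eq = true≢false (enum-true A i) (trans (cong A eq) (not-true (∧-trueʳ {low (enum B x) ∧ not (does (nbrs A (enum B x) <? suc t))} (B-true x))))
      -- |A| g is at most (t + 1) times the number of vertices, which is at most 4 (|A| + |B|);
      -- `g-large` turns this into |A| (D + 2) ≤ |A| + |B|.
      sum≤ : count A + count A * suc D ≤ count A + count B
      sum≤ = *-cancelˡ-≤ (4 * suc t) (begin
        4 * suc t * (count A + count A * suc D)        ≡⟨ solve 3 (λ T a D → con 4 :* T :* (a :+ a :* (con 1 :+ D)) := a :* (con 4 :* T :* (con 2 :+ D))) refl (suc t) (count A) D ⟩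
        count A * (4 * suc t * suc (suc D))            ≤⟨ *-monoʳ-≤ (count A) g-large ⟩
        count A * g                                    ≤⟨ small ⟩
        suc t * suc n                                  ≤⟨ *-monoʳ-≤ (suc t) cover ⟩
        suc t * (4 * (count A + count B))              ≡⟨ solve 2 (λ T x → T :* (con 4 :* x) := con 4 :* T :* x) refl (suc t) (count A + count B) ⟩
        4 * suc t * (count A + count B)                ∎)
      -- Strictness: if `A` is empty, the cover provides a rich vertex; otherwise D + 1 exceeds D.
      nonempty : ∀ k l → suc n ≤ 4 * (k + l) → k * suc D ≤ l → k * D < l
      nonempty zero    zero    cov le = contradiction cov λ ()
      nonempty zero    (suc l) cov le = s≤s z≤n
      nonempty (suc k) l       cov le = ≤-trans (s≤s (≤-trans (+-monoʳ-≤ D (*-monoʳ-≤ k (n≤1+n D))) ≤-refl)) le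
      many : count A * D < count B
      many = nonempty (count A) (count B) cover (+-cancelˡ-≤ (count A) _ _ sum≤)

  no-critical : ¬ Critical X d
  no-critical 𝒞 = absurd A small cover
    where
    open NoCritical 𝒞
    found = dominating-set (CriticalBounds.low-many 1≤d 𝒞)
    A = proj₁ found
    small = proj₁ (proj₂ found)
    cover = proj₂ (proj₂ found)

  total-bound : ∀ {n} (H : Graph (Fin n)) → X H → total H ≤ 2 * d * n
  total-bound H XH = ≮⇒≥ λ lt → no-critical (critical X her d H XH lt)

degree-bound : (X : GraphPred) {c t : ℕ} → 1 ≤ c → Hereditary X → HasSpeed X c → BicliqueFree X t →
  ∃ λ d₀ → ∀ {n} (H : Graph (Fin n)) → X H → total H ≤ d₀ * n
degree-bound X {c} {t} 1≤c her speed free = 2 * Parameters.d params , DegreeBound.total-bound X 1≤c her speed free refl params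
  where
  params : Parameters t (2 * (2 ^ 3 * (suc t * c)) ^ 3)
  params = parameters t _

-- Longer subdivisions (r ≥ 1)

-- The label of a path vertex points to the label of the next vertex of its path; such pointers are cheap because
-- path vertices have bounded degree.
module PathLinks {m n e ρ L : ℕ} (H : Graph (Fin m)) (a : Fin n → Fin m) (w : Fin (suc ρ) → Fin e → Fin m)
  (a-inj : Injective _≡_ _≡_ a) (w-inj : ∀ j → Injective _≡_ _≡_ (w j))
  (low : ∀ j x → degree H (w j x) ≤ L) where

  module Chain {K N : ℕ} (α : Fin N → Fin n) where

    nextRow : (Fin K → Fin e) → (Fin (suc ρ) → Permutation′ K) → Fin ρ → Fin K → Fin K → Bool
    nextRow u τ j q q' = adj H (w (inject₁ j) (u (τ (inject₁ j) ⟨$⟩ʳ q))) (w (suc j) (u (τ (suc j) ⟨$⟩ʳ q')))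

    branchRow : (Fin K → Fin e) → (Fin (suc ρ) → Permutation′ K) → Permutation′ N → Fin (suc ρ) → Fin K → Fin N → Bool
    branchRow u τ π j q l = adj H (w j (u (τ j ⟨$⟩ʳ q))) (a (α (π ⟨$⟩ʳ l)))

    nextCode : (Fin K → Fin e) → (Fin (suc ρ) → Permutation′ K) → Fin ρ → Fin K → Fin (suc L)
    nextCode u τ j q = pointer L (nextRow u τ j q) (τ (suc j) ⟨$⟩ˡ (τ (inject₁ j) ⟨$⟩ʳ q))

    -- The ends are pointed to from the path, because a branch vertex may have too many neighbours
    -- to point back.
    branchCode : (Fin K → Fin e) → (Fin (suc ρ) → Permutation′ K) → Permutation′ N → Fin (suc ρ) →
      (Fin K → Fin N) → Fin K → Fin (suc L)
    branchCode u τ π j end q = pointer L (branchRow u τ π j q) (π ⟨$⟩ˡ end (τ j ⟨$⟩ʳ q))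

    chainCode : (Fin K → Fin e) → (Fin (suc ρ) → Permutation′ K) → Permutation′ N → (Fin K → Fin N) → (Fin K → Fin N) →
      Fin ((suc L ^ K) ^ ρ * (suc L ^ K * suc L ^ K))
    chainCode u τ π start end = combine (funToFin (λ j → funToFin (nextCode u τ j)))
      (combine (funToFin (branchCode u τ π zero start)) (funToFin (branchCode u τ π (fromℕ ρ) end)))

    record Linked (u : Fin K → Fin e) (start end : Fin K → Fin N) : Set where
      field
        u-inj : Injective _≡_ _≡_ u
        next  : ∀ j x → adj H (w (inject₁ j) (u x)) (w (suc j) (u x)) ≡ true
        first-adj : ∀ x → adj H (w zero (u x)) (a (α (start x))) ≡ true
        last-adj  : ∀ x → adj H (w (fromℕ ρ) (u x)) (a (α (end x))) ≡ true

    -- Two families `u` and `u'` are compared, since two configurations may choose different links;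
    -- at this stage only labels can be matched, not the links themselves.
    module Decode (α-inj : Injective _≡_ _≡_ α) {u u' : Fin K → Fin e} {start start' end end' : Fin K → Fin N}
      (lk : Linked u start end) (lk' : Linked u' start' end')
      (τ τ' : Fin (suc ρ) → Permutation′ K) (π π' : Permutation′ N)
      (next-row : ∀ j q q' → nextRow u τ j q q' ≡ nextRow u' τ' j q q')
      (branch-row : ∀ j q l → branchRow u τ π j q l ≡ branchRow u' τ' π' j q l)
      (codes : chainCode u τ π start end ≡ chainCode u' τ' π' start' end') where

      open Linked

      private
        parts : funToFin (λ j → funToFin (nextCode u τ j)) ≡ funToFin (λ j → funToFin (nextCode u' τ' j))
          × combine (funToFin (branchCode u τ π zero start)) (funToFin (branchCode u τ π (fromℕ ρ) end))
            ≡ combine (funToFin (branchCode u' τ' π' zero start')) (funToFin (branchCode u' τ' π' (fromℕ ρ) end'))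
        parts = combine-injective (funToFin (λ j → funToFin (nextCode u τ j))) _ (funToFin (λ j → funToFin (nextCode u' τ' j))) _ codes

        next-code : ∀ j q → nextCode u τ j q ≡ nextCode u' τ' j q
        next-code j = funToFin-injective (funToFin-injective (proj₁ parts) j)

        branch-codes : funToFin (branchCode u τ π zero start) ≡ funToFin (branchCode u' τ' π' zero start')
          × funToFin (branchCode u τ π (fromℕ ρ) end) ≡ funToFin (branchCode u' τ' π' (fromℕ ρ) end')
        branch-codes = combine-injective (funToFin (branchCode u τ π zero start)) _ (funToFin (branchCode u' τ' π' zero start')) _ (proj₂ parts)

        next-few : ∀ j q → count (nextRow u τ j q) ≤ L
        next-few j q = ≤-trans (count-injective (nextRow u τ j q) (adj H (w (inject₁ j) (u (τ (inject₁ j) ⟨$⟩ʳ q))))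
          (λ q' _ → w (suc j) (u (τ (suc j) ⟨$⟩ʳ q'))) (λ _ _ _ _ eq → ⟨$⟩ʳ-injective (τ (suc j)) (u-inj lk (w-inj (suc j) eq)))
          (λ _ p → p)) (low _ _)

        branch-few : ∀ j q → count (branchRow u τ π j q) ≤ L
        branch-few j q = ≤-trans (count-injective (branchRow u τ π j q) (adj H (w j (u (τ j ⟨$⟩ʳ q))))
          (λ l _ → a (α (π ⟨$⟩ʳ l))) (λ _ _ _ _ eq → ⟨$⟩ʳ-injective π (α-inj (a-inj eq))) (λ _ p → p)) (low _ _)

        next-label : ∀ j q → τ (suc j) ⟨$⟩ˡ (τ (inject₁ j) ⟨$⟩ʳ q) ≡ τ' (suc j) ⟨$⟩ˡ (τ' (inject₁ j) ⟨$⟩ʳ q)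
        next-label j q = pointer-injective L (next-row j q) (next-few j q) (self lk τ) (self lk' τ') (next-code j q)
          where
          self : ∀ {v b d} → Linked v b d → ∀ υ → nextRow v υ j q (υ (suc j) ⟨$⟩ˡ (υ (inject₁ j) ⟨$⟩ʳ q)) ≡ true
          self {v} k υ = trans (cong (λ z → adj H (w (inject₁ j) (v (υ (inject₁ j) ⟨$⟩ʳ q))) (w (suc j) (v z))) (inverseʳ (υ (suc j)))) (next k j _)

        branch-label : ∀ j → {b b' : Fin K → Fin N} → (∀ q → branchCode u τ π j b q ≡ branchCode u' τ' π' j b' q) →
          (∀ x → adj H (w j (u x)) (a (α (b x))) ≡ true) → (∀ x → adj H (w j (u' x)) (a (α (b' x))) ≡ true) →
          ∀ q → π ⟨$⟩ˡ b (τ j ⟨$⟩ʳ q) ≡ π' ⟨$⟩ˡ b' (τ' j ⟨$⟩ʳ q)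
        branch-label j code h h' q = pointer-injective L (branch-row j q) (branch-few j q)
          (trans (cong (λ z → adj H (w j (u (τ j ⟨$⟩ʳ q))) (a (α z))) (inverseʳ π)) (h _))
          (trans (cong (λ z → adj H (w j (u' (τ' j ⟨$⟩ʳ q))) (a (α z))) (inverseʳ π')) (h' _)) (code q)

      -- Both sides are the label at position j of the path whose first vertex is labelled q. The
      -- pointers carry it from one position to the next.
      position : ∀ j q → τ j ⟨$⟩ˡ (τ zero ⟨$⟩ʳ q) ≡ τ' j ⟨$⟩ˡ (τ' zero ⟨$⟩ʳ q)
      position j q = <-weakInduction (λ j → τ j ⟨$⟩ˡ (τ zero ⟨$⟩ʳ q) ≡ τ' j ⟨$⟩ˡ (τ' zero ⟨$⟩ʳ q))
        (trans (inverseˡ (τ zero)) (sym (inverseˡ (τ' zero))))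
        (λ j ih → begin
          τ (suc j) ⟨$⟩ˡ (τ zero ⟨$⟩ʳ q)                                                      ≡⟨ cong (τ (suc j) ⟨$⟩ˡ_) (sym (inverseʳ (τ (inject₁ j)))) ⟩
          τ (suc j) ⟨$⟩ˡ (τ (inject₁ j) ⟨$⟩ʳ (τ (inject₁ j) ⟨$⟩ˡ (τ zero ⟨$⟩ʳ q)))             ≡⟨ next-label j _ ⟩
          τ' (suc j) ⟨$⟩ˡ (τ' (inject₁ j) ⟨$⟩ʳ (τ (inject₁ j) ⟨$⟩ˡ (τ zero ⟨$⟩ʳ q)))           ≡⟨ cong (λ z → τ' (suc j) ⟨$⟩ˡ (τ' (inject₁ j) ⟨$⟩ʳ z)) ih ⟩
          τ' (suc j) ⟨$⟩ˡ (τ' (inject₁ j) ⟨$⟩ʳ (τ' (inject₁ j) ⟨$⟩ˡ (τ' zero ⟨$⟩ʳ q)))         ≡⟨ cong (τ' (suc j) ⟨$⟩ˡ_) (inverseʳ (τ' (inject₁ j))) ⟩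
          τ' (suc j) ⟨$⟩ˡ (τ' zero ⟨$⟩ʳ q)                                                    ∎) j
        where open ≡-Reasoning

      start-label : ∀ q → π ⟨$⟩ˡ start (τ zero ⟨$⟩ʳ q) ≡ π' ⟨$⟩ˡ start' (τ' zero ⟨$⟩ʳ q)
      start-label = branch-label zero (funToFin-injective (proj₁ branch-codes)) (first-adj lk) (first-adj lk')

      end-label : ∀ q → π ⟨$⟩ˡ end (τ zero ⟨$⟩ʳ q) ≡ π' ⟨$⟩ˡ end' (τ' zero ⟨$⟩ʳ q)
      end-label q = begin
        π ⟨$⟩ˡ end (τ zero ⟨$⟩ʳ q)                                                ≡⟨ cong (λ z → π ⟨$⟩ˡ end z) (sym (inverseʳ (τ last))) ⟩
        π ⟨$⟩ˡ end (τ last ⟨$⟩ʳ (τ last ⟨$⟩ˡ (τ zero ⟨$⟩ʳ q)))                     ≡⟨ branch-label last (funToFin-injective (proj₂ branch-codes)) (last-adj lk) (last-adj lk') _ ⟩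
        π' ⟨$⟩ˡ end' (τ' last ⟨$⟩ʳ (τ last ⟨$⟩ˡ (τ zero ⟨$⟩ʳ q)))                  ≡⟨ cong (λ z → π' ⟨$⟩ˡ end' (τ' last ⟨$⟩ʳ z)) (position last q) ⟩
        π' ⟨$⟩ˡ end' (τ' last ⟨$⟩ʳ (τ' last ⟨$⟩ˡ (τ' zero ⟨$⟩ʳ q)))                ≡⟨ cong (λ z → π' ⟨$⟩ˡ end' z) (inverseʳ (τ' last)) ⟩
        π' ⟨$⟩ˡ end' (τ' zero ⟨$⟩ʳ q)                                             ∎
        where
        open ≡-Reasoning
        last = fromℕ ρ

      all-positions : (∀ q → u (τ zero ⟨$⟩ʳ q) ≡ u' (τ' zero ⟨$⟩ʳ q)) → ∀ j q → u (τ j ⟨$⟩ʳ q) ≡ u' (τ' j ⟨$⟩ʳ q)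
      all-positions heads j q = begin
        u (τ j ⟨$⟩ʳ q)                    ≡⟨ cong u (sym (inverseʳ (τ zero))) ⟩
        u (τ zero ⟨$⟩ʳ q₀)                ≡⟨ heads q₀ ⟩
        u' (τ' zero ⟨$⟩ʳ q₀)              ≡⟨ cong u' (sym (inverseʳ (τ' j))) ⟩
        u' (τ' j ⟨$⟩ʳ (τ' j ⟨$⟩ˡ (τ' zero ⟨$⟩ʳ q₀))) ≡⟨ cong (λ z → u' (τ' j ⟨$⟩ʳ z)) (sym (position j q₀)) ⟩
        u' (τ' j ⟨$⟩ʳ (τ j ⟨$⟩ˡ (τ zero ⟨$⟩ʳ q₀)))   ≡⟨ cong (λ z → u' (τ' j ⟨$⟩ʳ (τ j ⟨$⟩ˡ z))) (inverseʳ (τ zero)) ⟩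
        u' (τ' j ⟨$⟩ʳ (τ j ⟨$⟩ˡ (τ j ⟨$⟩ʳ q)))       ≡⟨ cong (λ z → u' (τ' j ⟨$⟩ʳ z)) (inverseˡ (τ j)) ⟩
        u' (τ' j ⟨$⟩ʳ q)                  ∎
        where
        open ≡-Reasoning
        -- The label of the first vertex on the path whose vertex at position j is labelled q.
        q₀ = τ zero ⟨$⟩ˡ (τ j ⟨$⟩ʳ q)

module Paths (X : GraphPred) {c : ℕ} (1≤c : 1 ≤ c) (her : Hereditary X) (speed : HasSpeed X c)
  {m n e ρ L : ℕ} (H : Graph (Fin m)) (H∈X : X H)
  (vert : Fin n ⊎ (Fin (suc ρ) × Fin e) → Fin m) (vert-inj : Injective _≡_ _≡_ vert)
  (source target : Fin e → Fin n)
  (simple : ∀ x y → source x ≡ source y → target x ≡ target y → x ≡ y)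
  (first-edge : ∀ x → adj H (vert (inj₂ (zero , x))) (vert (inj₁ (source x))) ≡ true)
  (next-edge : ∀ j x → adj H (vert (inj₂ (inject₁ j , x))) (vert (inj₂ (suc j , x))) ≡ true)
  (last-edge : ∀ x → adj H (vert (inj₂ (fromℕ ρ , x))) (vert (inj₁ (target x))) ≡ true)
  (low : ∀ j x → degree H (vert (inj₂ (j , x))) ≤ L) where

  private
    a : Fin n → Fin m
    a v = vert (inj₁ v)
    w : Fin (suc ρ) → Fin e → Fin m
    w j x = vert (inj₂ (j , x))
    a-inj : Injective _≡_ _≡_ a
    a-inj eq = inj₁-injective (vert-inj eq)
    w-inj : ∀ j → Injective _≡_ _≡_ (w j)
    w-inj j eq = cong proj₂ (inj₂-injective (vert-inj eq))

  open PathLinks {L = L} H a w a-inj w-inj low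

  ends : Fin e → Fin 2 → Fin n
  ends x zero       = source x
  ends x (suc zero) = target x

  -- Incidence with the subdivided edge instead of adjacency: no single vertex of the path sees both
  -- ends in general. Rows have at most two members, hence Δ = 2.
  I : Fin e → Fin n → Bool
  I x v = does (source x ≟ v) ∨ does (target x ≟ v)

  I-ends : ∀ x i → I x (ends x i) ≡ true
  I-ends x zero       = cong (_∨ does (target x ≟ source x)) (dec-true (source x ≟ source x) refl)
  I-ends x (suc zero) = trans (cong (does (source x ≟ target x) ∨_) (dec-true (target x ≟ target x) refl)) (Bool.∨-zeroʳ _)

  I-count : ∀ x → count (I x) ≤ 2
  I-count x = ≤-trans (sum-mono (b2n ∘ I x) (λ v → b2n (does (source x ≟ v)) + b2n (does (target x ≟ v)))
      (λ v → or≤ (does (source x ≟ v)) (does (target x ≟ v))))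
    (≤-trans (≤-reflexive (∑-distrib-+ (λ v → b2n (does (source x ≟ v))) (λ v → b2n (does (target x ≟ v)))))
      (+-mono-≤ (single (source x)) (single (target x))))
    where
    or≤ : ∀ p q → b2n (p ∨ q) ≤ b2n p + b2n q
    or≤ true  q = s≤s z≤n
    or≤ false q = ≤-refl
    single : ∀ v → count (λ v' → does (v ≟ v')) ≤ 1
    single v = count-injective (λ v' → does (v ≟ v')) (λ (_ : Fin 1) → true) (λ _ _ → zero)
      (λ v₁ v₂ p q _ → trans (sym (does-true (v ≟ v₁) p)) (does-true (v ≟ v₂) q)) (λ _ _ → refl)

  module _ {D μ s : ℕ} (sel : Selection ends I 2 D μ s) where
    open Selection sel
    open Embedded H vert vert-inj sel
    private
      module Core = Chain {N'} {N} α
      module Rest = Chain {μ * N} {N} α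

    coreEnd : Fin 2 → Fin N' → Fin N
    coreEnd i p = proj₁ (γ-ends p i)

    chosen : Conf → Fin (μ * N) → Fin e
    chosen C q = δ q (pick C q)

    restEnd : Conf → Fin 2 → Fin (μ * N) → Fin N
    restEnd C i q = proj₁ (δ-ends q (pick C q) i)

    core-linked : Core.Linked γ (coreEnd zero) (coreEnd (suc zero))
    core-linked = record
      { u-inj = γ-inj ; next = λ j p → next-edge j (γ p)
      ; first-adj = λ p → trans (cong (λ z → adj H (w zero (γ p)) (a z)) (proj₂ (γ-ends p zero))) (first-edge (γ p))
      ; last-adj  = λ p → trans (cong (λ z → adj H (w (fromℕ ρ) (γ p)) (a z)) (proj₂ (γ-ends p (suc zero)))) (last-edge (γ p)) }

    rest-linked : ∀ C → Rest.Linked (chosen C) (restEnd C zero) (restEnd C (suc zero))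
    rest-linked C = record
      { u-inj = λ eq → proj₁ (δ-inj eq) ; next = λ j q → next-edge j (chosen C q)
      ; first-adj = λ q → trans (cong (λ z → adj H (w zero (chosen C q)) (a z)) (proj₂ (δ-ends q (pick C q) zero))) (first-edge (chosen C q))
      ; last-adj  = λ q → trans (cong (λ z → adj H (w (fromℕ ρ) (chosen C q)) (a z)) (proj₂ (δ-ends q (pick C q) (suc zero)))) (last-edge (chosen C q)) }

    chain# : ℕ → ℕ
    chain# K = (suc L ^ K) ^ ρ * (suc L ^ K * suc L ^ K)

    coreCode : Conf → Fin (chain# N')
    coreCode C = Core.chainCode γ (κ C) (π C) (coreEnd zero) (coreEnd (suc zero))

    restCode : Conf → Fin (chain# (μ * N))
    restCode C = Rest.chainCode (chosen C) (σ C) (π C) (restEnd C zero) (restEnd C (suc zero))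

    light : Conf → Fin (chain# N' * chain# (μ * N))
    light C = combine (coreCode C) (restCode C)

    -- A path with ρ + 1 inner vertices stores ρ + 2 pointers: ρ along the path and two to its ends.
    -- Two per vertex cover them, whence the squared base.
    chain#≤ : ∀ K → chain# K ≤ (suc L * suc L) ^ (suc ρ * K)
    chain#≤ K = begin
      (l ^ K) ^ ρ * (l ^ K * l ^ K)              ≡⟨ cong₂ _*_ (trans (^-*-assoc l K ρ) (cong (l ^_) (*-comm K ρ))) (sym (^-distribʳ-* K l l)) ⟩
      l ^ (ρ * K) * (l * l) ^ K                  ≤⟨ *-monoˡ-≤ ((l * l) ^ K) (^-monoˡ-≤ (ρ * K) (m≤m*n l l)) ⟩
      (l * l) ^ (ρ * K) * (l * l) ^ K            ≡⟨ *-comm ((l * l) ^ (ρ * K)) ((l * l) ^ K) ⟩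
      (l * l) ^ K * (l * l) ^ (ρ * K)            ≡⟨ sym (^-distribˡ-+-* (l * l) K (ρ * K)) ⟩
      (l * l) ^ (suc ρ * K)                      ∎
      where
      open ≤-Reasoning
      l = suc L

    light-few : chain# N' * chain# (μ * N) ≤ (suc L * suc L) ^ #L
    light-few = ≤-trans (*-mono-≤ (chain#≤ N') (chain#≤ (μ * N)))
      (≤-trans (≤-reflexive (sym (^-distribˡ-+-* (suc L * suc L) (suc ρ * N') (suc ρ * (μ * N)))))
        (^-monoʳ-≤ (suc L * suc L) (m≤n+m _ N)))

    module _ (C C' : Conf) (codes : light C ≡ light C') (same : Pattern C C') where

      private
        halves : coreCode C ≡ coreCode C' × restCode C ≡ restCode C'
        halves = combine-injective (coreCode C) (restCode C) (coreCode C') (restCode C') codes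

        module CD = Core.Decode α-inj core-linked core-linked (κ C) (κ C') (π C) (π C')
          (λ j p p' → same (inj₂ (inj₁ (inject₁ j , p))) (inj₂ (inj₁ (suc j , p'))))
          (λ j p l → same (inj₂ (inj₁ (j , p))) (inj₁ l)) (proj₁ halves)

        module RD = Rest.Decode α-inj (rest-linked C) (rest-linked C') (σ C) (σ C') (π C) (π C')
          (λ j p p' → same (inj₂ (inj₂ (inject₁ j , p))) (inj₂ (inj₂ (suc j , p'))))
          (λ j p l → same (inj₂ (inj₂ (j , p))) (inj₁ l)) (proj₂ halves)

        end-of : ∀ (τ : Permutation′ N) {v z b} → α b ≡ v → v ≡ α (τ ⟨$⟩ʳ z) → τ ⟨$⟩ˡ b ≡ z
        end-of τ h eq = trans (cong (τ ⟨$⟩ˡ_) (α-inj (trans h eq))) (inverseˡ τ)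

        of-end : ∀ (τ : Permutation′ N) {v z b} → α b ≡ v → τ ⟨$⟩ˡ b ≡ z → v ≡ α (τ ⟨$⟩ʳ z)
        of-end τ h eq = trans (sym h) (cong α (trans (sym (inverseʳ τ)) (cong (τ ⟨$⟩ʳ_) eq)))

        same-end : ∀ {v v' z b b'} → α b ≡ v → α b' ≡ v' → π C ⟨$⟩ˡ b ≡ π C' ⟨$⟩ˡ b' →
          does (v ≟ α (π C ⟨$⟩ʳ z)) ≡ does (v' ≟ α (π C' ⟨$⟩ʳ z))
        same-end h h' eq = does-⇔ (mk⇔
          (λ p → of-end (π C') h' (trans (sym eq) (end-of (π C) h p)))
          (λ p → of-end (π C) h (trans eq (end-of (π C') h' p)))) (_ ≟ _) (_ ≟ _)

      links-same : SameLinks C C'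
      links-same p v = cong₂ _∨_
        (same-end (proj₂ (γ-ends _ zero)) (proj₂ (γ-ends _ zero)) (CD.start-label p))
        (same-end (proj₂ (γ-ends _ (suc zero))) (proj₂ (γ-ends _ (suc zero))) (CD.end-label p))

      all-same : SameCore C C' → C ≈ C'
      all-same (π≡ , κ≡) = record
        { π≈ = π≡
        ; κ≈ = λ j p → γ-inj (CD.all-positions (λ q → cong γ (κ≡ q)) j p)
        ; σ≈ = λ j q → proj₁ (δ-inj (RD.all-positions heads j q))
        ; pick≈ = λ r → trans (cong (pick C) (sym (inverseʳ (σ C zero)))) (trans (proj₂ (δ-inj (heads (σ C zero ⟨$⟩ˡ r))))
                    (cong (pick C') (trans (sym (proj₁ (δ-inj (heads (σ C zero ⟨$⟩ˡ r))))) (inverseʳ (σ C zero)))))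
        }
        where
        same-index : ∀ {b b'} → π C ⟨$⟩ˡ b ≡ π C' ⟨$⟩ˡ b' → b ≡ b'
        same-index eq = trans (sym (inverseʳ (π C))) (trans (cong (π C ⟨$⟩ʳ_) eq) (trans (π≡ _) (inverseʳ (π C'))))
        -- Both configurations give the ends the same labels, hence the same branch vertices, and
        -- these determine the subdivided edge.
        heads : ∀ q → chosen C (σ C zero ⟨$⟩ʳ q) ≡ chosen C' (σ C' zero ⟨$⟩ʳ q)
        heads q = simple _ _
          (trans (sym (proj₂ (δ-ends _ _ zero))) (trans (cong α (same-index (RD.start-label q))) (proj₂ (δ-ends _ _ zero))))
          (trans (sym (proj₂ (δ-ends _ _ (suc zero)))) (trans (cong α (same-index (RD.end-label q))) (proj₂ (δ-ends _ _ (suc zero)))))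

    paths-impossible : 1 ≤ μ → (3 * suc (suc D)) * 3 < 2 ^ μ →
      s ≡ 2 * (2 ^ (3 + ρ) * ((suc L * suc L) * c)) ^ (1 + 2 * suc ρ) → ⊥
    paths-impossible = impossible X c 1≤c her speed H∈X light (suc L * suc L) (s≤s z≤n) light-few links-same all-same

-- From a dense graph to many subdivided edges with inner vertices of low degree

sum-+ : ∀ m {n} (f : Fin (m + n) → ℕ) → sum f ≡ sum (λ i → f (i ↑ˡ n)) + sum (λ j → f (m ↑ʳ j))
sum-+ zero    f = refl
sum-+ (suc m) f = trans (cong (f zero +_) (sum-+ m (f ∘ suc))) (sym (+-assoc (f zero) _ _))

sum-combine : ∀ m {k} (f : Fin (m * k) → ℕ) → sum f ≡ sum {m} (λ i → sum {k} (λ j → f (combine i j)))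
sum-combine zero        f = refl
sum-combine (suc m) {k} f = trans (sum-+ k f) (cong (sum (λ j → f (j ↑ˡ (m * k))) +_) (sum-combine m (λ j → f (k ↑ʳ j))))

module Edges {n : ℕ} (G : Graph (Fin n)) where

  isEdge : Fin n → Fin n → Bool
  isEdge i j = does (toℕ i <? toℕ j) ∧ adj G i j

  flat : Fin (n * n) → Bool
  flat x = uncurry isEdge (remQuot {n} n x)

  #edges : ℕ
  #edges = count flat

  ends-of : Fin #edges → Fin n × Fin n
  ends-of x = remQuot {n} n (enum flat x)

  edge : Fin #edges → Edge G
  edge x = ends-of x , does-true (toℕ (proj₁ (ends-of x)) <? toℕ (proj₂ (ends-of x))) (∧-trueˡ (enum-true flat x))
    , ≡⇒T (∧-trueʳ {does (toℕ (proj₁ (ends-of x)) <? toℕ (proj₂ (ends-of x)))} (enum-true flat x))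

  ends-injective : ∀ {x y} → ends-of x ≡ ends-of y → x ≡ y
  ends-injective {x} {y} eq = enum-injective flat x y (remQuot-injective {n} n _ _ eq)

  total≤edges : total G ≤ 2 * #edges
  total≤edges = begin
    sum (λ i → sum (λ j → b2n (adj G i j)))          ≤⟨ sum-mono _ (λ i → sum (λ j → fwd i j + fwd j i)) (λ i → sum-mono _ (λ j → fwd i j + fwd j i) (either i)) ⟩
    sum (λ i → sum (λ j → fwd i j + fwd j i))        ≡⟨ sum-cong-≗ {n} (λ i → ∑-distrib-+ (fwd i) (λ j → fwd j i)) ⟩
    sum (λ i → sum (fwd i) + sum (λ j → fwd j i))    ≡⟨ ∑-distrib-+ (λ i → sum (fwd i)) (λ i → sum (λ j → fwd j i)) ⟩
    S + sum (λ i → sum (λ j → fwd j i))              ≡⟨ cong (S +_) (∑-comm (λ i j → fwd j i)) ⟩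
    S + S                                            ≡⟨ cong (S +_) (sym (+-identityʳ S)) ⟩
    2 * S                                            ≡⟨ cong (2 *_) S≡ ⟩
    2 * #edges                                       ∎
    where
    open ≤-Reasoning
    fwd : Fin n → Fin n → ℕ
    fwd i j = b2n (isEdge i j)
    S : ℕ
    S = sum (λ i → sum (fwd i))
    S≡ : S ≡ #edges
    S≡ = sym (trans (sum-combine n (b2n ∘ flat)) (sum-cong-≗ {n} (λ i → sum-cong-≗ {n} (λ j →
      cong (b2n ∘ uncurry isEdge) (remQuot-combine i j)))))
    either : ∀ i j → b2n (adj G i j) ≤ fwd i j + fwd j i
    either i j = go (toℕ i <? toℕ j) (toℕ j <? toℕ i)
      where
      go : (p : Dec (toℕ i < toℕ j)) (q : Dec (toℕ j < toℕ i)) →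
        b2n (adj G i j) ≤ b2n (does p ∧ adj G i j) + b2n (does q ∧ adj G j i)
      go (yes _) q       = m≤m+n _ _
      go (no _)  (yes _) = ≤-reflexive (cong b2n (adj-sym G i j))
      go (no ¬p) (no ¬q) with refl ← toℕ-injective (≤-antisym (≮⇒≥ ¬q) (≮⇒≥ ¬p)) =
        ≤-trans (≤-reflexive (cong b2n (irrefl G i))) z≤n

record PathParameters (s : ℕ) : Set where
  field
    μ D     : ℕ
    1≤μ     : 1 ≤ μ
    D-large : 2 * suc (s * μ) ≤ D
    cost    : (3 * suc (suc D)) * 3 < 2 ^ μ

-- Now Δ = 2, which gives the two factors 3, and 9 (D + 2) is at most 9 (2 s + 4) (μ + 1) for D = 2
-- (s μ + 1).
path-parameters : ∀ s → PathParameters s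
path-parameters s = build (9 * (2 * s + 4)) refl
  where
  open +-*-Solver
  build : ∀ a → 9 * (2 * s + 4) ≡ a → PathParameters s
  build a e = assemble _ refl
    where
    μ = proj₁ (cubic<exponential a)
    fast = proj₂ (cubic<exponential a)
    positive : ∀ μ → 1 ≤ a → a * (suc μ * (suc μ * suc μ)) < 2 ^ μ → 1 ≤ μ
    positive zero    1≤a lt = contradiction (*-mono-≤ 1≤a (≤-refl {1})) (<⇒≱ lt)
    positive (suc μ) _   _  = s≤s z≤n
    1≤a : 1 ≤ a
    1≤a = subst (1 ≤_) e (*-mono-≤ {1} {9} (s≤s z≤n) (≤-trans (s≤s z≤n) (m≤n+m 4 (2 * s))))
    bound : ∀ s μ → (3 * suc (suc (2 * suc (s * μ)))) * 3 ≤ 9 * (2 * s + 4) * suc μ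
    bound s μ = ≤-trans (m≤m+n _ (18 * s + 36 * μ)) (≤-reflexive
      (solve 2 (λ s m → con 3 :* (con 2 :+ con 2 :* (con 1 :+ s :* m)) :* con 3 :+ (con 18 :* s :+ con 36 :* m)
        := con 9 :* (con 2 :* s :+ con 4) :* (con 1 :+ m)) refl s μ))
    assemble : ∀ D → 2 * suc (s * μ) ≡ D → PathParameters s
    assemble D eD = record
      { 1≤μ = positive μ 1≤a fast
      ; D-large = ≤-reflexive eD
      ; cost = ≤-<-trans (≤-trans (subst₂ (λ x y → (3 * suc (suc x)) * 3 ≤ y * suc μ) eD e (bound s μ))
                 (*-monoʳ-≤ a (m≤m*n (suc μ) (suc μ * suc μ)))) fast
      }

module Subdivision (X : GraphPred) {c d₀ : ℕ} (1≤c : 1 ≤ c) (her : Hereditary X) (speed : HasSpeed X c)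
  (sparse : ∀ {n} (H : Graph (Fin n)) → X H → total H ≤ d₀ * n)
  {ρ L s : ℕ} (L≡ : L ≡ 2 * (suc d₀ * (2 + ρ)))
  (s≡ : s ≡ 2 * (2 ^ (3 + ρ) * ((suc L * suc L) * c)) ^ (1 + 2 * suc ρ)) (params : PathParameters s)
  {n : ℕ} (G : Graph (Fin n)) {m : ℕ} (H₀ : Graph (Fin m)) (H₀∈X : X H₀)
  (φ : SubdivV G (suc ρ) → Fin m) (φ-inj : Injective _≡_ _≡_ φ)
  (φ-edge : ∀ x y → T (subdivAdj G (suc ρ) x y) → T (adj H₀ (φ x) (φ y))) where

  open PathParameters params
  open Edges G

  private
    Vertex : Set
    Vertex = Fin n ⊎ (Fin (suc ρ) × Fin #edges)

    toφ : Vertex → SubdivV G (suc ρ)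
    toφ (inj₁ v)       = inj₁ v
    toφ (inj₂ (j , x)) = inj₂ (edge x , j)

    toφ-inj : Injective _≡_ _≡_ toφ
    toφ-inj {inj₁ _} {inj₁ _} refl = refl
    toφ-inj {inj₂ (j , x)} {inj₂ (j' , y)} eq = cong₂ (λ i z → inj₂ (i , z))
      (cong proj₂ (inj₂-injective eq)) (ends-injective (cong (proj₁ ∘ proj₁) (inj₂-injective eq)))
    toφ-inj {inj₁ _} {inj₂ _} ()
    toφ-inj {inj₂ _} {inj₁ _} ()

    size : ℕ
    size = n + suc ρ * #edges

    vertices : Fin size ↔ Vertex
    vertices = ↔-trans +↔⊎ (↔-refl ⊎-↔ *↔×)

    open Inverse vertices using (to; from; strictlyInverseˡ; strictlyInverseʳ)

    from-inj : Injective _≡_ _≡_ from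
    from-inj {u} {v} eq = trans (sym (strictlyInverseˡ u)) (trans (cong to eq) (strictlyInverseˡ v))

    -- Only the vertices of the subdivision are kept, so that the sparse bound is in terms of `size`
    -- and thus of the number of paths. Edges of `H₀` outside the subdivision remain, which is why
    -- path vertices can have large degree.
    H : Graph (Fin size)
    H = induced H₀ (φ ∘ toφ ∘ to)

    H∈X : X H
    H∈X = her H₀ (φ ∘ toφ ∘ to) (λ {u} {v} eq → trans (sym (strictlyInverseʳ u))
      (trans (cong from (toφ-inj (φ-inj eq))) (strictlyInverseʳ v))) H₀∈X

    edge-H : ∀ u v → subdivAdj₀ G (suc ρ) (toφ u) (toφ v) ≡ true → adj H (from u) (from v) ≡ true
    edge-H u v h = trans (cong₂ (λ x y → adj H₀ (φ (toφ x)) (φ (toφ y))) (strictlyInverseˡ u) (strictlyInverseˡ v))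
      (T⇒≡ (φ-edge (toφ u) (toφ v) (≡⇒T (cong (_∨ subdivAdj₀ G (suc ρ) (toφ v) (toφ u)) h))))

    eqFin-refl : ∀ {k} (v : Fin k) → eqFin v v ≡ true
    eqFin-refl v = trans (isYes≗does (v ≟ v)) (dec-true (v ≟ v) refl)

    ≡ᵇ-refl : ∀ {a b} → a ≡ b → (a ≡ᵇ b) ≡ true
    ≡ᵇ-refl {a} {b} eq = T⇒≡ (≡⇒≡ᵇ a b eq)

    source₀ target₀ : Fin #edges → Fin n
    source₀ x = proj₁ (ends-of x)
    target₀ x = proj₂ (ends-of x)

    first₀ : ∀ x → adj H (from (inj₂ (zero , x))) (from (inj₁ (source₀ x))) ≡ true
    first₀ x = trans (adj-sym H _ _) (edge-H (inj₁ (source₀ x)) (inj₂ (zero , x))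
      (cong₂ _∨_ (∧-true (eqFin-refl (source₀ x)) (refl {x = true})) refl))

    last₀ : ∀ x → adj H (from (inj₂ (fromℕ ρ , x))) (from (inj₁ (target₀ x))) ≡ true
    last₀ x = trans (adj-sym H _ _) (edge-H (inj₁ (target₀ x)) (inj₂ (fromℕ ρ , x))
      (∨-trueʳ (eqFin (target₀ x) (source₀ x) ∧ (toℕ (fromℕ ρ) ≡ᵇ 0)) (∧-true (eqFin-refl (target₀ x)) (≡ᵇ-refl (cong suc (toℕ-fromℕ ρ))))))
      where
      ∨-trueʳ : ∀ p {q} → q ≡ true → p ∨ q ≡ true
      ∨-trueʳ p refl = Bool.∨-zeroʳ p

    next₀ : ∀ j x → adj H (from (inj₂ (inject₁ j , x))) (from (inj₂ (suc j , x))) ≡ true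
    next₀ j x = edge-H (inj₂ (inject₁ j , x)) (inj₂ (suc j , x))
      (∧-true (eqFin-refl (source₀ x)) (∧-true (eqFin-refl (target₀ x)) (≡ᵇ-refl (cong suc (toℕ-inject₁ j)))))

    path-degree : Fin #edges → Fin (suc ρ) → ℕ
    path-degree x j = degree H (from (inj₂ (j , x)))

    Bad : Fin #edges → Set
    Bad x = ∃ λ j → L < path-degree x j

    bad? : ∀ x → Dec (Bad x)
    bad? x = any? (λ j → L <? path-degree x j)

    bad good : Fin #edges → Bool
    bad x = does (bad? x)
    good x = not (bad x)

    good-low : ∀ x → good x ≡ true → ∀ j → path-degree x j ≤ L
    good-low x p j = ≮⇒≥ λ lt → does-false (bad? x) (not-true p) (j , lt)

    bad-degrees : L * count bad ≤ total H
    bad-degrees = begin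
      L * count bad                                                  ≡⟨ *-distribˡ-sum L (b2n ∘ bad) ⟩
      sum (λ x → L * b2n (bad x))                                    ≤⟨ sum-mono _ (λ x → sum (path-degree x)) (λ x → one x (bad? x)) ⟩
      sum (λ x → sum (path-degree x))                                ≡⟨ ∑-comm path-degree ⟩
      sum (λ j → sum (λ x → path-degree x j))                        ≡⟨ sym (sum-combine (suc ρ) (λ z → degree H (n ↑ʳ z))) ⟩
      sum {suc ρ * #edges} (λ z → degree H (n ↑ʳ z))                                  ≤⟨ m≤n+m _ (sum {n} (λ v → degree H (v ↑ˡ (suc ρ * #edges)))) ⟩
      sum {n} (λ v → degree H (v ↑ˡ (suc ρ * #edges))) + sum {suc ρ * #edges} (λ z → degree H (n ↑ʳ z)) ≡⟨ sym (sum-+ n (degree H)) ⟩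
      total H                                                        ∎
      where
      open ≤-Reasoning
      one : ∀ x (p : Dec (Bad x)) → L * b2n (does p) ≤ sum (path-degree x)
      one x (no _)         = ≤-trans (≤-reflexive (*-zeroʳ L)) z≤n
      one x (yes (j , lt)) = ≤-trans (≤-reflexive (*-identityʳ L)) (≤-trans (<⇒≤ lt) (term≤sum (path-degree x) j))

  module _ (dense : 4 * D * n < total G) where

    private
      dense' : 2 * (n * D) < #edges
      dense' = *-cancelˡ-< 2 _ _ (<-≤-trans (≤-<-trans (≤-reflexive (solve 2 (λ D n → con 2 :* (con 2 :* (n :* D)) := con 4 :* D :* n) refl D n)) dense) total≤edges)
        where open +-*-Solver

      n≤edges : n ≤ #edges
      n≤edges = ≤-trans (m≤m*n n D {{>-nonZero (≤-trans (s≤s z≤n) D-large)}}) (≤-trans (m≤n+m (n * D) _) (<⇒≤ (≤-<-trans (≤-reflexive (cong (n * D +_) (sym (+-identityʳ (n * D))))) dense')))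

      -- Each bad path accounts for more than L of the total degree, which is at most (d₀ + 1) (2 +
      -- ρ) times the number of paths because n is at most that number; L is twice this factor.
      bad-few : 2 * count bad ≤ #edges
      bad-few = *-cancelˡ-≤ (suc d₀ * (2 + ρ)) (begin
        suc d₀ * (2 + ρ) * (2 * count bad)          ≡⟨ solve 2 (λ a b → a :* (con 2 :* b) := con 2 :* a :* b) refl (suc d₀ * (2 + ρ)) (count bad) ⟩
        2 * (suc d₀ * (2 + ρ)) * count bad          ≡⟨ cong (_* count bad) (sym L≡) ⟩
        L * count bad                               ≤⟨ bad-degrees ⟩
        total H                                     ≤⟨ sparse H H∈X ⟩
        d₀ * (n + suc ρ * #edges)                   ≤⟨ *-mono-≤ (n≤1+n d₀) (+-monoˡ-≤ (suc ρ * #edges) n≤edges) ⟩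
        suc d₀ * ((2 + ρ) * #edges)                 ≡⟨ sym (*-assoc (suc d₀) (2 + ρ) #edges) ⟩
        suc d₀ * (2 + ρ) * #edges                   ∎)
        where
        open ≤-Reasoning
        open +-*-Solver

      good-many : n * D < count good
      good-many = *-cancelˡ-< 2 _ _ (<-≤-trans dense' (+-cancelˡ-≤ (2 * count bad) _ _ (begin
        2 * count bad + #edges                      ≤⟨ +-monoˡ-≤ #edges bad-few ⟩
        #edges + #edges                             ≡⟨ cong (#edges +_) (sym (+-identityʳ #edges)) ⟩
        2 * #edges                                  ≡⟨ cong (2 *_) (trans (sym (count-all #edges)) (count-split (λ _ → true) bad)) ⟩
        2 * (count bad + count good)                ≡⟨ *-distribˡ-+ 2 (count bad) (count good) ⟩
        2 * count bad + 2 * count good              ∎)))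
        where open ≤-Reasoning

      path : Fin (count good) → Fin #edges
      path = enum good

      vert : Fin n ⊎ (Fin (suc ρ) × Fin (count good)) → Fin size
      vert (inj₁ v)       = from (inj₁ v)
      vert (inj₂ (j , x)) = from (inj₂ (j , path x))

      vert-inj : Injective _≡_ _≡_ vert
      vert-inj {inj₁ u} {inj₁ v} eq = cong inj₁ (inj₁-injective (from-inj {inj₁ u} {inj₁ v} eq))
      vert-inj {inj₂ (j , x)} {inj₂ (j' , y)} eq = cong₂ (λ i z → inj₂ (i , z))
        (cong proj₁ eq') (enum-injective good x y (cong proj₂ eq'))
        where
        eq' : (j , path x) ≡ (j' , path y)
        eq' = inj₂-injective (from-inj {inj₂ (j , path x)} {inj₂ (j' , path y)} eq)
      vert-inj {inj₁ u} {inj₂ (j , x)} eq = contradiction (from-inj {inj₁ u} {inj₂ (j , path x)} eq) λ ()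
      vert-inj {inj₂ (j , x)} {inj₁ u} eq = contradiction (from-inj {inj₂ (j , path x)} {inj₁ u} eq) λ ()

      module P = Paths X 1≤c her speed {L = L} H H∈X vert vert-inj (source₀ ∘ path) (target₀ ∘ path)
        (λ x y p q → enum-injective good x y (ends-injective (cong₂ _,_ p q)))
        (first₀ ∘ path) (λ j x → next₀ j (path x)) (last₀ ∘ path) (λ j x → good-low (path x) (enum-true good x) j)

    subdivision-impossible : ⊥
    subdivision-impossible = P.paths-impossible
      (selection-exists P.ends P.I P.I-ends 2 P.I-count D μ s D-large good-many) 1≤μ cost s≡

-- Combination of the cases r = 0 and r ≥ 1

total-mono : ∀ {n} (G H : Graph (Fin n)) → (∀ i j → adj G i j ≡ true → adj H i j ≡ true) → total G ≤ total H
total-mono G H sub = sum-mono (degree G) (degree H) (λ i → count-mono (adj G i) (adj H i) (sub i))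

-- Makes the constant positive, as `blocks-win` requires of its base.
HasSpeed-suc : (X : GraphPred) (c : ℕ) → HasSpeed X c → HasSpeed X (suc c)
HasSpeed-suc X c speed n L members distinct =
  ≤-trans (speed n L members distinct) (*-monoʳ-≤ (n !) (^-monoˡ-≤ n (n≤1+n c)))

NoSubdivision : GraphPred → ℕ → ℕ → Set
NoSubdivision X r f = ∀ {n} (G : Graph (Fin n)) → f * n < total G → ∀ {m} (H : Graph (Fin m)) → X H →
  ¬ (_⊆ᵍ_ {SubdivV G r} {Fin m} (subdivAdj G r) (adj H))

expansion-bound : (X : GraphPred) {c d₀ : ℕ} → 1 ≤ c → Hereditary X → HasSpeed X c →
  (∀ {n} (H : Graph (Fin n)) → X H → total H ≤ d₀ * n) → ∀ r → ∃ (NoSubdivision X r)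
expansion-bound X {c} {d₀} 1≤c her speed sparse zero = d₀ , λ G dense H XH (φ , φ-inj , φ-edge) →
  <⇒≱ dense (≤-trans
    (total-mono G (induced H (φ ∘ inj₁)) (λ i j h → T⇒≡ (φ-edge (inj₁ i) (inj₁ j) (≡⇒T (cong (_∨ adj G j i) h)))))
    (sparse (induced H (φ ∘ inj₁)) (her H (φ ∘ inj₁) (λ eq → inj₁-injective (φ-inj eq)) XH)))
expansion-bound X {c} {d₀} 1≤c her speed sparse (suc ρ) = from _ refl _ refl (path-parameters _)
  where
  from : ∀ L → L ≡ 2 * (suc d₀ * (2 + ρ)) →
    ∀ s → s ≡ 2 * (2 ^ (3 + ρ) * ((suc L * suc L) * c)) ^ (1 + 2 * suc ρ) → PathParameters s → ∃ (NoSubdivision X (suc ρ))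
  -- The factor 4: `total` counts every edge twice, and up to half of the paths may be bad.
  from L L≡ s s≡ params = 4 * PathParameters.D params , λ G dense H XH (φ , φ-inj , φ-edge) →
    Subdivision.subdivision-impossible X {d₀ = d₀} 1≤c her speed sparse L≡ s≡ params G H XH φ φ-inj φ-edge dense

theorem1p1 : (X : GraphPred) → IsoClosed X → Hereditary X → Small X → WeaklySparse X →
    BoundedExpansion X
theorem1p1 X _ her (c , small) (t , free) =
  (λ r → proj₁ (bound r)) , λ r {n} G dense → proj₂ (bound r) G (subst (proj₁ (bound r) * n <_) (degSum≡total G) dense)
  where
  speed : HasSpeed X (suc c)
  speed = HasSpeed-suc X c small
  sparse : ∃ λ d₀ → ∀ {n} (H : Graph (Fin n)) → X H → total H ≤ d₀ * n
  sparse = degree-bound X (s≤s z≤n) her speed free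
  bound : ∀ r → ∃ (NoSubdivision X r)
  bound = expansion-bound X {d₀ = proj₁ sparse} (s≤s z≤n) her speed (proj₂ sparse)
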